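{- $h_{2\times 4}\le 191.35$.
   Context: A $2\times 4$ block is a subset of $\mathbb{R}^3$ of the form $[x,x+2]\times[y,y+4]\times[z,z+1]$ or $[x,x+4]\times[y,y+2]\times[z,z+1]$ with $x,y,z\in\mathbb{Z}$. A building is a finite set of blocks with pairwise disjoint interiors. Two blocks of a building are attached if their $z$-coordinates differ by exactly $1$ and their projections to the $xy$-plane overlap in a set with nonempty interior (i.e. at least one stud of the lower block is inserted into the upper block). A building is contiguous if the graph on its blocks given by attachment is connected. Two buildings are identified if one is mapped onto the other by a composition of translations of $\mathbb{R}^3$ and rotations about vertical axes (rotations in the $xy$-plane, by multiples of $90^\circ$). $T_{2\times 4}(n)$ denotes the number of contiguous buildings consisting of exactly $n$ such blocks, counted up to this identification. The entropy is $s_{2\times 4}=\lim_{n\to\infty}\frac{\log(T_{2\times 4}(n))}{n}$ (this limit exists and is finite), and $h_{2\times 4}=\exp(s_{2\times 4})$. -}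

module Defs where

open import Data.Nat.Base as ℕ using (ℕ; zero; suc)
import Data.Nat.Properties as ℕ
open import Data.Integer.Base as ℤ using (ℤ; +_; 0ℤ; 1ℤ)
import Data.Integer.Properties as ℤ
open import Data.Integer.Solver using (module +-*-Solver)
import Data.Rational.Base
open import Data.Rational.Base as ℚ using (ℚ; 0ℚ; 1ℚ; ½)
import Data.Rational.Properties as ℚ
import Data.Rational.Solver as ℚSolver
open import Data.Fin.Base using (Fin)
open import Data.Product using (Σ; ∃; ∃₂; _×_; _,_; proj₁; proj₂)
open import Data.Sum using (_⊎_)
open import Function.Base using (_on_)
open import Function.Bundles using (Bijection)
open import Level using (0ℓ)
open import Relation.Binary.Bundles using (Setoid)
open import Relation.Binary.Construct.Closure.ReflexiveTransitive using (Star)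
open import Relation.Binary.PropositionalEquality
  using (_≡_; _≢_; refl; sym; trans; cong; cong₂; subst; setoid)
open import Relation.Nullary using (¬_)

data Orientation : Set where
  2×4 4×2 : Orientation

width depth : Orientation → ℕ
width 2×4 = 2
width 4×2 = 4
depth 2×4 = 4
depth 4×2 = 2

-- The block [x, x + width] × [y, y + depth] × [z, z + 1]; distinct
-- elements of Block are distinct subsets of ℝ³.

record Block : Set where
  constructor block
  field
    orientation : Orientation
    x y z       : ℤ

open Block public

-- The unit square [i, i + 1] × [j, j + 1] lies in the projection of b.

Covers : Block → ℤ → ℤ → Set
Covers b i j =
  (x b ℤ.≤ i × i ℤ.< x b ℤ.+ + width (orientation b)) ×
  (y b ℤ.≤ j × j ℤ.< y b ℤ.+ + depth (orientation b))

-- As corners are integral, projections overlap in a set with nonempty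
-- interior exactly when they share a unit square (a stud).

ShareStud : Block → Block → Set
ShareStud a b = ∃₂ λ i j → Covers a i j × Covers b i j

InteriorsDisjoint : Block → Block → Set
InteriorsDisjoint a b = ¬ (z a ≡ z b × ShareStud a b)

Attached : Block → Block → Set
Attached a b = (z a ≡ z b ℤ.+ 1ℤ ⊎ z b ≡ z a ℤ.+ 1ℤ) × ShareStud a b

-- A set of n blocks, listed in some order.  The listing is automatically
-- free of repetitions, since no block has interior disjoint from itself.

record ContiguousBuilding (n : ℕ) : Set where
  field
    blocks     : Fin n → Block
    disjoint   : ∀ i j → i ≢ j → InteriorsDisjoint (blocks i) (blocks j)
    contiguous : ∀ i j → Star (Attached on blocks) i j

open ContiguousBuilding public

-- Compositions of translations and quarter turns.  Integral translations
-- and quarter turns about the z-axis suffice: any composition of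
-- translations and rotations as in the identification of buildings that
-- sends some block to a block is a composition of these.

data Motion : Set where
  translate : (a b c : ℤ) → Motion
  rotate    : Motion
  _⊚_       : Motion → Motion → Motion

turn : Orientation → Orientation
turn 2×4 = 4×2
turn 4×2 = 2×4

-- The quarter turn is (p , q) ↦ (- q , p), sending [x, x + w] × [y, y + d]
-- to [- (y + d), - y] × [x, x + w].

act : Motion → Block → Block
act (translate a b c) (block o x y z) = block o (x ℤ.+ a) (y ℤ.+ b) (z ℤ.+ c)
act rotate            (block o x y z) =
  block (turn o) (ℤ.- (y ℤ.+ + depth o)) x z
act (f ⊚ g)           B               = act f (act g B)

-- The image of A under some motion equals B, as sets of blocks.

_≅_ : ∀ {n} → ContiguousBuilding n → ContiguousBuilding n → Set
A ≅ B = Σ Motion λ m →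
  (∀ i → ∃ λ j → act m (blocks A i) ≡ blocks B j) ×
  (∀ j → ∃ λ i → act m (blocks A i) ≡ blocks B j)

private
  block-cong : ∀ {o x x′ y y′ z z′} → x ≡ x′ → y ≡ y′ → z ≡ z′ →
               block o x y z ≡ block o x′ y′ z′
  block-cong refl refl refl = refl

  act-identity : ∀ b → act (translate 0ℤ 0ℤ 0ℤ) b ≡ b
  act-identity (block o x y z) =
    block-cong (ℤ.+-identityʳ x) (ℤ.+-identityʳ y) (ℤ.+-identityʳ z)

  inverse : Motion → Motion
  inverse (translate a b c) = translate (ℤ.- a) (ℤ.- b) (ℤ.- c)
  inverse rotate            = rotate ⊚ (rotate ⊚ rotate)
  inverse (f ⊚ g)           = inverse g ⊚ inverse f

  act-inverse : ∀ m b → act (inverse m) (act m b) ≡ b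
  act-inverse (translate a b c) (block o x y z) =
    block-cong (cancel x a) (cancel y b) (cancel z c)
    where
    open +-*-Solver
    cancel : ∀ p q → p ℤ.+ q ℤ.+ ℤ.- q ≡ p
    cancel = solve 2 (λ p q → p :+ q :+ (:- q) := p) refl
  act-inverse rotate (block o x y z) with o
  ... | 2×4 = block-cong (cancel x _) (cancel y _) refl
    where
    open +-*-Solver
    cancel : ∀ p q → ℤ.- (ℤ.- (p ℤ.+ q) ℤ.+ q) ≡ p
    cancel = solve 2 (λ p q → :- (:- (p :+ q) :+ q) := p) refl
  ... | 4×2 = block-cong (cancel x _) (cancel y _) refl
    where
    open +-*-Solver
    cancel : ∀ p q → ℤ.- (ℤ.- (p ℤ.+ q) ℤ.+ q) ≡ p
    cancel = solve 2 (λ p q → :- (:- (p :+ q) :+ q) := p) refl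
  act-inverse (f ⊚ g) b =
    trans (cong (act (inverse g)) (act-inverse f (act g b))) (act-inverse g b)

  undo : ∀ m {a b} → act m a ≡ b → act (inverse m) b ≡ a
  undo m {a} eq = trans (cong (act (inverse m)) (sym eq)) (act-inverse m a)

Buildings : ℕ → Setoid 0ℓ 0ℓ
Buildings n = record
  { Carrier       = ContiguousBuilding n
  ; _≈_           = _≅_
  ; isEquivalence = record
    { refl  = λ {A} → translate 0ℤ 0ℤ 0ℤ
            , (λ i → i , act-identity (blocks A i))
            , (λ i → i , act-identity (blocks A i))
    ; sym   = λ { (m , to , from) → inverse m
            , (λ j → proj₁ (from j) , undo m (proj₂ (from j)))
            , (λ i → proj₁ (to i) , undo m (proj₂ (to i))) }
    ; trans = λ { (m , to , from) (m′ , to′ , from′) → (m′ ⊚ m)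
            , (λ i → let j , eq = to i ; k , eq′ = to′ j in
                     k , trans (cong (act m′) eq) eq′)
            , (λ k → let j , eq′ = from′ k ; i , eq = from j in
                     i , trans (cong (act m′) eq) eq′) }
    }
  }

CountsBuildings : (ℕ → ℕ) → Set
CountsBuildings T = ∀ n → Bijection (setoid (Fin (T n))) (Buildings n)

IsCauchy : (ℕ → ℚ) → Set
IsCauchy s = ∀ ε → 0ℚ ℚ.< ε → ∃ λ N → ∀ m n → N ℕ.≤ m → N ℕ.≤ n →
             ℚ.∣ s m ℚ.- s n ∣ ℚ.≤ ε

record ℝ : Set where
  constructor mkℝ
  field
    seq    : ℕ → ℚ
    cauchy : IsCauchy seq

open ℝ public

infix  4 _≤ʳ_
infixl 6 _+ʳ_
infixl 7 _*ʳ_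
infixr 8 _^ʳ_

_≤ʳ_ : ℝ → ℝ → Set
x ≤ʳ y = ∀ ε → 0ℚ ℚ.< ε → ∃ λ N → ∀ n → N ℕ.≤ n → seq x n ℚ.≤ seq y n ℚ.+ ε

fromℚ : ℚ → ℝ
fromℚ q = mkℝ (λ _ → q) λ ε 0<ε →
  0 , λ _ _ _ _ → subst (λ r → ℚ.∣ r ∣ ℚ.≤ ε) (sym (ℚ.+-inverseʳ q)) (ℚ.<⇒≤ 0<ε)

fromℕ : ℕ → ℝ
fromℕ n = fromℚ (+ n ℚ./ 1)

private
  open Data.Rational.Base using ()
    renaming (_+_ to _⊕_; _*_ to _⊗_; _-_ to _⊖_; ∣_∣ to abs)
  open ℚ.≤-Reasoning

  half : ∀ ε → ½ ⊗ ε ⊕ ½ ⊗ ε ≡ ε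
  half ε = trans (sym (ℚ.*-distribʳ-+ ε ½ ½)) (ℚ.*-identityˡ ε)

  half-pos : ∀ ε → 0ℚ ℚ.< ε → 0ℚ ℚ.< ½ ⊗ ε
  half-pos ε 0<ε =
    ℚ.positive⁻¹ (½ ⊗ ε) {{ℚ.pos*pos⇒pos ½ ε {{ℚ.positive 0<ε}}}}

  +-cauchy : ∀ {s t} → IsCauchy s → IsCauchy t → IsCauchy (λ n → s n ⊕ t n)
  +-cauchy {s} {t} cs ct ε 0<ε
    with cs (½ ⊗ ε) (half-pos ε 0<ε) | ct (½ ⊗ ε) (half-pos ε 0<ε)
  ... | M , hs | N , ht = M ℕ.⊔ N , λ m n m≥ n≥ → begin
    abs ((s m ⊕ t m) ⊖ (s n ⊕ t n))    ≡⟨ cong abs (regroup (s m) (t m) (s n) (t n)) ⟩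
    abs ((s m ⊖ s n) ⊕ (t m ⊖ t n))    ≤⟨ ℚ.∣p+q∣≤∣p∣+∣q∣ (s m ⊖ s n) (t m ⊖ t n) ⟩
    abs (s m ⊖ s n) ⊕ abs (t m ⊖ t n)
      ≤⟨ ℚ.+-mono-≤
           (hs m n (ℕ.m⊔n≤o⇒m≤o M N m≥) (ℕ.m⊔n≤o⇒m≤o M N n≥))
           (ht m n (ℕ.m⊔n≤o⇒n≤o M N m≥) (ℕ.m⊔n≤o⇒n≤o M N n≥)) ⟩
    ½ ⊗ ε ⊕ ½ ⊗ ε                      ≡⟨ half ε ⟩
    ε                                  ∎
    where
    open ℚSolver.+-*-Solver
    regroup : ∀ a b c d → (a ⊕ b) ⊖ (c ⊕ d) ≡ (a ⊖ c) ⊕ (b ⊖ d)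
    regroup = solve 4 (λ a b c d →
      (a :+ b) :- (c :+ d) := (a :- c) :+ (b :- d)) refl

  -- A Cauchy sequence is eventually bounded in absolute value.
  bounded : ∀ {s} → IsCauchy s →
            ∃ λ B → 0ℚ ℚ.< B × ∃ λ N → ∀ n → N ℕ.≤ n → abs (s n) ℚ.≤ B
  bounded {s} cs with cs 1ℚ (ℚ.positive⁻¹ 1ℚ)
  ... | N , h = 1ℚ ⊕ abs (s N)
      , ℚ.+-mono-<-≤ (ℚ.positive⁻¹ 1ℚ) (ℚ.0≤∣p∣ (s N))
      , N , λ n n≥ → begin
    abs (s n)                       ≡⟨ cong abs (split (s n) (s N)) ⟩
    abs ((s n ⊖ s N) ⊕ s N)         ≤⟨ ℚ.∣p+q∣≤∣p∣+∣q∣ (s n ⊖ s N) (s N) ⟩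
    abs (s n ⊖ s N) ⊕ abs (s N)     ≤⟨ ℚ.+-mono-≤ (h n N n≥ ℕ.≤-refl) ℚ.≤-refl ⟩
    1ℚ ⊕ abs (s N)                  ∎
    where
    open ℚSolver.+-*-Solver
    split : ∀ a b → a ≡ (a ⊖ b) ⊕ b
    split = solve 2 (λ a b → a := (a :- b) :+ b) refl

  scale : ∀ B ε → 0ℚ ℚ.< B → 0ℚ ℚ.< ε →
          ∃ λ δ → 0ℚ ℚ.< δ × B ⊗ δ ≡ ε
  scale B ε 0<B 0<ε = B⁻¹ ⊗ ε
      , ℚ.positive⁻¹ (B⁻¹ ⊗ ε)
          {{ℚ.pos*pos⇒pos B⁻¹ {{ℚ.1/pos⇒pos B {{B>0}}}} ε {{ℚ.positive 0<ε}}}}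
      , trans (sym (ℚ.*-assoc B B⁻¹ ε))
          (trans (cong (_⊗ ε) (ℚ.*-inverseʳ B {{B≠0}})) (ℚ.*-identityˡ ε))
    where
    B>0 : ℚ.Positive B
    B>0 = ℚ.positive 0<B
    B≠0 : ℚ.NonZero B
    B≠0 = ℚ.pos⇒nonZero B {{B>0}}
    B⁻¹ : ℚ
    B⁻¹ = (ℚ.1/ B) {{B≠0}}

  *-mono : ∀ p q B δ → abs p ℚ.≤ B → 0ℚ ℚ.< B → abs q ℚ.≤ δ →
           abs (p ⊗ q) ℚ.≤ B ⊗ δ
  *-mono p q B δ p≤B 0<B q≤δ = begin
    abs (p ⊗ q)      ≡⟨ ℚ.∣p*q∣≡∣p∣*∣q∣ p q ⟩
    abs p ⊗ abs q    ≤⟨ ℚ.*-monoʳ-≤-nonNeg (abs q) {{ℚ.nonNegative (ℚ.0≤∣p∣ q)}} p≤B ⟩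
    B ⊗ abs q        ≤⟨ ℚ.*-monoˡ-≤-nonNeg B {{ℚ.nonNegative (ℚ.<⇒≤ 0<B)}} q≤δ ⟩
    B ⊗ δ            ∎

  *-regroup : ∀ a b c d → a ⊗ b ⊖ c ⊗ d ≡ a ⊗ (b ⊖ d) ⊕ d ⊗ (a ⊖ c)
  *-regroup = solve 4 (λ a b c d →
    a :* b :- c :* d := a :* (b :- d) :+ d :* (a :- c)) refl
    where open ℚSolver.+-*-Solver

  *-close : ∀ a b c d B C δ η → 0ℚ ℚ.< B → 0ℚ ℚ.< C →
            abs a ℚ.≤ B → abs d ℚ.≤ C → abs (b ⊖ d) ℚ.≤ δ → abs (a ⊖ c) ℚ.≤ η →
            abs (a ⊗ b ⊖ c ⊗ d) ℚ.≤ B ⊗ δ ⊕ C ⊗ η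
  *-close a b c d B C δ η 0<B 0<C a≤B d≤C b-d≤δ a-c≤η = begin
    abs (a ⊗ b ⊖ c ⊗ d)
      ≡⟨ cong abs (*-regroup a b c d) ⟩
    abs (a ⊗ (b ⊖ d) ⊕ d ⊗ (a ⊖ c))
      ≤⟨ ℚ.∣p+q∣≤∣p∣+∣q∣ (a ⊗ (b ⊖ d)) (d ⊗ (a ⊖ c)) ⟩
    abs (a ⊗ (b ⊖ d)) ⊕ abs (d ⊗ (a ⊖ c))
      ≤⟨ ℚ.+-mono-≤ (*-mono a (b ⊖ d) B δ a≤B 0<B b-d≤δ)
                    (*-mono d (a ⊖ c) C η d≤C 0<C a-c≤η) ⟩
    B ⊗ δ ⊕ C ⊗ η
      ∎

  *-cauchy : ∀ {s t} → IsCauchy s → IsCauchy t → IsCauchy (λ n → s n ⊗ t n)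
  *-cauchy {s} {t} cs ct ε 0<ε =
    let B , 0<B , K , hB = bounded {s} cs
        C , 0<C , L , hC = bounded {t} ct
        δ , 0<δ , Bδ = scale B (½ ⊗ ε) 0<B (half-pos ε 0<ε)
        η , 0<η , Cη = scale C (½ ⊗ ε) 0<C (half-pos ε 0<ε)
        M , ht = ct δ 0<δ
        N , hs = cs η 0<η
        ≥KL : ∀ {k} → (K ℕ.⊔ L) ℕ.⊔ (M ℕ.⊔ N) ℕ.≤ k → K ℕ.⊔ L ℕ.≤ k
        ≥KL = ℕ.m⊔n≤o⇒m≤o (K ℕ.⊔ L) (M ℕ.⊔ N)
        ≥MN : ∀ {k} → (K ℕ.⊔ L) ℕ.⊔ (M ℕ.⊔ N) ℕ.≤ k → M ℕ.⊔ N ℕ.≤ k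
        ≥MN = ℕ.m⊔n≤o⇒n≤o (K ℕ.⊔ L) (M ℕ.⊔ N)
    in (K ℕ.⊔ L) ℕ.⊔ (M ℕ.⊔ N) , λ m n m≥ n≥ →
       subst (abs (s m ⊗ t m ⊖ s n ⊗ t n) ℚ.≤_)
         (trans (cong₂ _⊕_ Bδ Cη) (half ε))
         (*-close (s m) (t m) (s n) (t n) B C δ η 0<B 0<C
           (hB m (ℕ.m⊔n≤o⇒m≤o K L (≥KL m≥)))
           (hC n (ℕ.m⊔n≤o⇒n≤o K L (≥KL n≥)))
           (ht m n (ℕ.m⊔n≤o⇒m≤o M N (≥MN m≥)) (ℕ.m⊔n≤o⇒m≤o M N (≥MN n≥)))
           (hs m n (ℕ.m⊔n≤o⇒n≤o M N (≥MN m≥)) (ℕ.m⊔n≤o⇒n≤o M N (≥MN n≥))))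

_+ʳ_ : ℝ → ℝ → ℝ
x +ʳ y = mkℝ (λ n → seq x n ℚ.+ seq y n)
             (+-cauchy {seq x} {seq y} (cauchy x) (cauchy y))

_*ʳ_ : ℝ → ℝ → ℝ
x *ʳ y = mkℝ (λ n → seq x n ℚ.* seq y n)
             (*-cauchy {seq x} {seq y} (cauchy x) (cauchy y))

_^ʳ_ : ℝ → ℕ → ℝ
x ^ʳ zero  = fromℚ 1ℚ
x ^ʳ suc n = x *ʳ x ^ʳ n

infixl 7 _÷_
_÷_ : ℝ → (n : ℕ) .{{_ : ℕ.NonZero n}} → ℝ
x ÷ n = x *ʳ fromℚ (+ 1 ℚ./ n)

infix 4 _⟶_
_⟶_ : (ℕ → ℝ) → ℝ → Set
u ⟶ l = ∀ ε → 0ℚ ℚ.< ε → ∃ λ N → ∀ n → N ℕ.≤ n →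
        (u n ≤ʳ l +ʳ fromℚ ε) × (l ≤ʳ u n +ʳ fromℚ ε)

-- The graph of exp:  y = lim (1 + x / n) ^ n.

infix 4 _IsExpOf_ _IsLogOf_
_IsExpOf_ : ℝ → ℝ → Set
y IsExpOf x = (λ n → (fromℚ 1ℚ +ʳ x ÷ suc n) ^ʳ suc n) ⟶ y

_IsLogOf_ : ℝ → ℝ → Set
l IsLogOf t = t IsExpOf l

-- s is the limit of log (T n) / n over n ≥ 1.

IsEntropy : (ℕ → ℕ) → ℝ → Set
IsEntropy T s = Σ (ℕ → ℝ) λ logT →
  (∀ n → logT n IsLogOf fromℕ (T n)) ×
  ((λ n → logT (suc n) ÷ suc n) ⟶ s)

{-# OPTIONS --safe #-}

-- Discover a building from one of its blocks by asking, for one position next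
-- to a known block after another, whether a block sits there.  Answers settled
-- by the known blocks (the parent of a block, positions overlapping a
-- discovered block) are not asked for.  The answers determine the building up
-- to translation, so the number of buildings is at most the number of leaves
-- of the decision tree.  If each newly discovered block gets weight 1 / 55,
-- then the configurations on the side of a block away from its parent weigh in
-- total at most 2.003, and those on the side of its parent at most 1.605.
-- Since 55 * 2.003 * 1.605 < 180, each discovery costs a factor of at most 180,
-- whence T (n + 1) ≤ 10 * 180 ^ n.
--
-- For the passage to the limit, (1 + l / (N M)) ^ (N M) is the N-th power of
-- (1 + (l / N) / M) ^ M, so l = log T(N) gives exp (l / N) ≤ 181, and s is
-- close to l / N.  The gap between 181 and 191.35 absorbs all errors.

module Submission where

open import Defs
open import Algebra.Bundles using (CommutativeRing)
open import Data.Empty using (⊥-elim)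
open import Data.Fin.Base using (Fin)
import Data.Fin.Properties as Fin
open import Data.Integer.Base as ℤ using (ℤ; +_; 0ℤ; 1ℤ)
import Data.Integer.Properties as ℤ
open import Data.Integer.Solver using (module +-*-Solver)
open import Data.List.Base using
  ( List; []; _∷_; length; filter; map; lookup; tabulate; upTo
  ; cartesianProduct; cartesianProductWith)
open import Data.List.Membership.Propositional using (_∈_; _∉_; find; lose)
import Data.List.Membership.DecPropositional as DecMembership
open import Data.List.Membership.Propositional.Properties using
  ( ∈-filter⁺; ∈-lookup; ∈-upTo⁺; ∈-cartesianProduct⁺; ∈-cartesianProductWith⁺)
open import Data.List.Properties using (length-filter; length-tabulate)
open import Data.List.Relation.Unary.All as All using (All; []; _∷_)
import Data.List.Relation.Unary.All.Properties as All
open import Data.List.Relation.Unary.AllPairs using (AllPairs; []; _∷_)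
import Data.List.Relation.Unary.AllPairs.Properties as AllPairs
open import Data.List.Relation.Unary.Any using (Any; here; there)
open import Data.List.Relation.Unary.Unique.Propositional using (Unique)
open import Data.Nat.Base as ℕ using (ℕ; zero; suc; z≤n; s≤s)
open import Data.Nat.DivMod using (m≡m%n+[m/n]*n; m%n<n)
open import Data.Nat.ListAction using (product)
import Data.Nat.Properties as ℕ
import Data.Nat.Solver as ℕSolver
open import Data.Product using (∃; ∃₂; _×_; _,_; proj₁; proj₂; uncurry)
open import Data.Rational.Base as ℚ using (ℚ; mkℚ; 0ℚ; 1ℚ; ½; _/_)
import Data.Rational.Properties as ℚ
import Data.Rational.Solver as ℚSolver
open import Data.Rational.Unnormalised.Base as ℚᵘ using (mkℚᵘ)
import Data.Rational.Unnormalised.Properties as ℚᵘ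
open import Data.Sum using (_⊎_; inj₁; inj₂; [_,_]′)
open import Function.Base using (_∘_; _on_; id)
open import Function.Bundles using (Bijection)
open import Relation.Binary.Bundles using (Setoid)
open import Relation.Binary.Construct.Closure.ReflexiveTransitive as Star
  using (Star; _◅_)
open import Relation.Binary.Definitions using (DecidableEquality)
open import Relation.Binary.PropositionalEquality
open import Relation.Nullary using (Dec; yes; no; ¬_; ¬?; contradiction)
open import Relation.Nullary.Decidable using (_×-dec_; from-yes; map′)
open import Relation.Unary using (Decidable; Pred)
open import Algebra.Properties.CommutativeSemiring.Exp
  (CommutativeRing.commutativeSemiring ℚ.+-*-commutativeRing)
  using (_^_; ^-assocʳ; ^-distrib-*)

-- Neighbouring positions

-- Blocks on the adjacent levels are located relative to a block with corner
-- (x , y) by the natural coordinates of their corner in the frame with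
-- origin (x - 3 , y - 3); the block itself sits at (3 , 3).

record Spot : Set where
  constructor spot
  field
    facing  : Orientation
    col row : ℕ
open Spot public

Meet : Spot → Spot → Set
Meet (spot o i j) (spot o′ i′ j′) =
  (i ℕ.< i′ ℕ.+ width o′ × i′ ℕ.< i ℕ.+ width o) ×
  (j ℕ.< j′ ℕ.+ depth o′ × j′ ℕ.< j ℕ.+ depth o)

meet? : ∀ p q → Dec (Meet p q)
meet? (spot o i j) (spot o′ i′ j′) =
  (i ℕ.<? i′ ℕ.+ width o′ ×-dec i′ ℕ.<? i ℕ.+ width o) ×-dec
  (j ℕ.<? j′ ℕ.+ depth o′ ×-dec j′ ℕ.<? j ℕ.+ depth o)

clear : Spot → List Spot → List Spot
clear p = filter (λ q → ¬? (meet? p q))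

-- Sides are at most 4, so a block sharing a stud with the one at (3 , 3) has its corner displaced
-- by at most 3 in each direction: coordinates run from 0 to 6.
grid : List Spot
grid = cartesianProductWith (λ o → uncurry (spot o))
  (2×4 ∷ 4×2 ∷ []) (cartesianProduct (upTo 7) (upTo 7))

spots : Orientation → List Spot
spots o = filter (meet? (spot o 3 3)) grid

-- The spot of a block of orientation o seen from its neighbour at spot p.

parent : Orientation → Spot → Spot
parent o (spot _ i j) = spot o (6 ℕ.∸ i) (6 ℕ.∸ j)

-- The candidates on the side of the parent. Whatever overlaps the parent is excluded, including the
-- parent's own spot, which meets itself.
near : Orientation → Spot → List Spot
near o p = clear (parent o p) (spots (facing p))

data Side : Set where
  above below : Side

level : Side → ℤ → ℤ
level above h = h ℤ.+ 1ℤ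
level below h = h ℤ.- 1ℤ

opposite : Side → Side
opposite above = below
opposite below = above

level-opposite : ∀ d h → level (opposite d) (level d h) ≡ h
level-opposite above = solve 1 (λ h → (h :+ con 1ℤ) :- con 1ℤ := h) refl
  where open +-*-Solver
level-opposite below = solve 1 (λ h → (h :- con 1ℤ) :+ con 1ℤ := h) refl
  where open +-*-Solver

shift : ℤ → ℕ → ℤ
shift a i = a ℤ.- + 3 ℤ.+ + i

place : Block → Side → Spot → Block
place (block _ x y z) d (spot o i j) = block o (shift x i) (shift y j) (level d z)

-- Seen from the other block, the displacement i - 3 changes sign, and 3 - i = (6 - i) - 3; the
-- bound on `i` makes the truncated subtraction exact.
shift-parent : ∀ {i} a → i ℕ.≤ 6 → shift (shift a i) (6 ℕ.∸ i) ≡ a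
shift-parent {i} a i≤6 = begin
  a ℤ.- + 3 ℤ.+ + i ℤ.- + 3 ℤ.+ + (6 ℕ.∸ i)
    ≡⟨ regroup a (+ i) (+ (6 ℕ.∸ i)) ⟩
  a ℤ.- + 6 ℤ.+ + (i ℕ.+ (6 ℕ.∸ i))
    ≡⟨ cong (λ m → a ℤ.- + 6 ℤ.+ + m) (ℕ.m+[n∸m]≡n i≤6) ⟩
  a ℤ.- + 6 ℤ.+ + 6
    ≡⟨ cancel a ⟩
  a ∎
  where
  open ≡-Reasoning
  open +-*-Solver
  regroup : ∀ a i j → a ℤ.- + 3 ℤ.+ i ℤ.- + 3 ℤ.+ j ≡ a ℤ.- + 6 ℤ.+ (i ℤ.+ j)
  regroup = solve 3 (λ a i j → a :- con (+ 3) :+ i :- con (+ 3) :+ j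
                               := a :- con (+ 6) :+ (i :+ j)) refl
  cancel : ∀ a → a ℤ.- + 6 ℤ.+ + 6 ≡ a
  cancel = solve 1 (λ a → a :- con (+ 6) :+ con (+ 6) := a) refl

block-cong : ∀ {o x x′ y y′ z z′} → x ≡ x′ → y ≡ y′ → z ≡ z′ →
             block o x y z ≡ block o x′ y′ z′
block-cong refl refl refl = refl

place-parent : ∀ b d p → col p ℕ.≤ 6 → row p ℕ.≤ 6 →
               place (place b d p) (opposite d) (parent (orientation b) p) ≡ b
place-parent (block o x y z) d (spot _ i j) i≤6 j≤6 =
  block-cong (shift-parent x i≤6) (shift-parent y j≤6) (level-opposite d z)

shift-< : ∀ a {i j w} → i ℕ.< j ℕ.+ w → shift a i ℤ.< shift a j ℤ.+ + w
shift-< a {i} {j} {w} i<j+w =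
  subst (λ e → shift a i ℤ.< e) (sym (ℤ.+-assoc (a ℤ.- + 3) (+ j) (+ w)))
    (ℤ.+-monoʳ-< (a ℤ.- + 3) (ℤ.+<+ i<j+w))

shift-≤ : ∀ a {i j} → i ℕ.≤ j → shift a i ℤ.≤ shift a j
shift-≤ a i≤j = ℤ.+-monoʳ-≤ (a ℤ.- + 3) (ℤ.+≤+ i≤j)

-- The largest of the lower ends lies in both intervals.
common : ∀ a {i j v w} → 0 ℕ.< v → 0 ℕ.< w → i ℕ.< j ℕ.+ w → j ℕ.< i ℕ.+ v →
  ∃ λ t → (shift a i ℤ.≤ t × t ℤ.< shift a i ℤ.+ + v) ×
          (shift a j ℤ.≤ t × t ℤ.< shift a j ℤ.+ + w)
common a {i} {j} {v} {w} 0<v 0<w i<j+w j<i+v = shift a (i ℕ.⊔ j)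
  , (shift-≤ a (ℕ.m≤m⊔n i j)
    , shift-< a (ℕ.⊔-lub (ℕ.m<m+n i 0<v) j<i+v))
  , (shift-≤ a (ℕ.m≤n⊔m i j)
    , shift-< a (ℕ.⊔-lub i<j+w (ℕ.m<m+n j 0<w)))

0<width : ∀ o → 0 ℕ.< width o
0<width 2×4 = ℕ.z<s
0<width 4×2 = ℕ.z<s

0<depth : ∀ o → 0 ℕ.< depth o
0<depth 2×4 = ℕ.z<s
0<depth 4×2 = ℕ.z<s

meet⇒share : ∀ b d p q → Meet p q → ShareStud (place b d p) (place b d q)
meet⇒share (block _ x y _) d (spot o i j) (spot o′ i′ j′) ((a , b) , (c , e)) =
  let s , s∈p , s∈q = common x (0<width o) (0<width o′) a b
      t , t∈p , t∈q = common y (0<depth o) (0<depth o′) c e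
  in s , t , (s∈p , t∈p) , (s∈q , t∈q)

-a+[a+b]≡b : ∀ a b → ℤ.- a ℤ.+ (a ℤ.+ b) ≡ b
-a+[a+b]≡b = solve 2 (λ a b → (:- a) :+ (a :+ b) := b) refl
  where open +-*-Solver

+-cancelˡ-≤ : ∀ a {b c} → a ℤ.+ b ℤ.≤ a ℤ.+ c → b ℤ.≤ c
+-cancelˡ-≤ a {b} {c} =
  subst₂ ℤ._≤_ (-a+[a+b]≡b a b) (-a+[a+b]≡b a c) ∘ ℤ.+-monoʳ-≤ (ℤ.- a)

+-cancelˡ-< : ∀ a {b c} → a ℤ.+ b ℤ.< a ℤ.+ c → b ℤ.< c
+-cancelˡ-< a {b} {c} =
  subst₂ ℤ._<_ (-a+[a+b]≡b a b) (-a+[a+b]≡b a c) ∘ ℤ.+-monoʳ-< (ℤ.- a)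

-- By integrality, a < c + w ≤ c + 4 gives a - 3 ≤ c, so c - (a - 3) is a natural coordinate. The
-- two overlap conditions become those of `Meet` against a corner at 3.
offset : ∀ a c {v w} → v ℕ.≤ 4 → w ℕ.≤ 4 → a ℤ.< c ℤ.+ + w → c ℤ.< a ℤ.+ + v →
         ∃ λ i → c ≡ shift a i × 3 ℕ.< i ℕ.+ w × i ℕ.< 3 ℕ.+ v
offset a c {v} {w} v≤4 w≤4 a<c+w c<a+v =
  i , c≡ , ℤ.drop‿+<+ (+-cancelˡ-< a′ lower) , ℤ.drop‿+<+ (+-cancelˡ-< a′ upper)
  where
  open +-*-Solver
  a′ : ℤ
  a′ = a ℤ.- + 3
  a′+3 : a′ ℤ.+ + 3 ≡ a
  a′+3 = solve 1 (λ a → a :- con (+ 3) :+ con (+ 3) := a) refl a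
  a′≤c : a′ ℤ.≤ c
  a′≤c = +-cancelˡ-≤ (+ 4) (begin
    + 4 ℤ.+ a′           ≡⟨ solve 1 (λ a → con (+ 4) :+ (a :- con (+ 3)) := con 1ℤ :+ a) refl a ⟩
    ℤ.suc a              ≤⟨ ℤ.i<j⇒suc[i]≤j a<c+w ⟩
    c ℤ.+ + w            ≤⟨ ℤ.+-monoʳ-≤ c (ℤ.+≤+ w≤4) ⟩
    c ℤ.+ + 4            ≡⟨ ℤ.+-comm c (+ 4) ⟩
    + 4 ℤ.+ c            ∎)
    where open ℤ.≤-Reasoning
  i : ℕ
  i = ℤ.∣ c ℤ.- a′ ∣
  c≡ : c ≡ a′ ℤ.+ + i
  c≡ = begin
    c                     ≡⟨ solve 2 (λ a c → c := a :+ (c :- a)) refl a′ c ⟩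
    a′ ℤ.+ (c ℤ.- a′)     ≡⟨ cong (λ e → a′ ℤ.+ e) (sym (ℤ.0≤i⇒+∣i∣≡i (ℤ.i≤j⇒0≤j-i a′≤c))) ⟩
    a′ ℤ.+ + i            ∎
    where open ≡-Reasoning
  lower : a′ ℤ.+ + 3 ℤ.< a′ ℤ.+ + (i ℕ.+ w)
  lower = begin-strict
    a′ ℤ.+ + 3            ≡⟨ a′+3 ⟩
    a                     <⟨ a<c+w ⟩
    c ℤ.+ + w             ≡⟨ cong (λ e → e ℤ.+ + w) c≡ ⟩
    a′ ℤ.+ + i ℤ.+ + w    ≡⟨ ℤ.+-assoc a′ (+ i) (+ w) ⟩
    a′ ℤ.+ + (i ℕ.+ w)    ∎
    where open ℤ.≤-Reasoning
  upper : a′ ℤ.+ + i ℤ.< a′ ℤ.+ + (3 ℕ.+ v)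
  upper = begin-strict
    a′ ℤ.+ + i            ≡⟨ sym c≡ ⟩
    c                     <⟨ c<a+v ⟩
    a ℤ.+ + v             ≡⟨ cong (λ e → e ℤ.+ + v) (sym a′+3) ⟩
    a′ ℤ.+ + 3 ℤ.+ + v    ≡⟨ ℤ.+-assoc a′ (+ 3) (+ v) ⟩
    a′ ℤ.+ + (3 ℕ.+ v)    ∎
    where open ℤ.≤-Reasoning

width≤4 : ∀ o → width o ℕ.≤ 4
width≤4 2×4 = s≤s (s≤s z≤n)
width≤4 4×2 = ℕ.≤-refl

depth≤4 : ∀ o → depth o ℕ.≤ 4
depth≤4 2×4 = ℕ.≤-refl
depth≤4 4×2 = s≤s (s≤s z≤n)

∈-grid : ∀ o {i j} → i ℕ.< 7 → j ℕ.< 7 → spot o i j ∈ grid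
∈-grid o i<7 j<7 = ∈-cartesianProductWith⁺ (λ o → uncurry (spot o))
  (orientations o) (∈-cartesianProduct⁺ (∈-upTo⁺ i<7) (∈-upTo⁺ j<7))
  where
  orientations : ∀ o → o ∈ 2×4 ∷ 4×2 ∷ []
  orientations 2×4 = here refl
  orientations 4×2 = there (here refl)

share⇒spot : ∀ d b c → z c ≡ level d (z b) → ShareStud b c →
             ∃ λ p → p ∈ spots (orientation b) × place b d p ≡ c
share⇒spot d (block o x y _) (block o′ x′ y′ _) refl
  (s , t , ((x≤s , s<x) , (y≤t , t<y)) , ((x′≤s , s<x′) , (y′≤t , t<y′)))
  with offset x x′ (width≤4 o) (width≤4 o′)
         (ℤ.≤-<-trans x≤s s<x′) (ℤ.≤-<-trans x′≤s s<x)
     | offset y y′ (depth≤4 o) (depth≤4 o′)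
         (ℤ.≤-<-trans y≤t t<y′) (ℤ.≤-<-trans y′≤t t<y)
... | i , refl , 3<i+w , i<3+v | j , refl , 3<j+d , j<3+e =
  spot o′ i j
  , ∈-filter⁺ (meet? (spot o 3 3))
      (∈-grid o′ (ℕ.<-≤-trans i<3+v (ℕ.+-monoʳ-≤ 3 (width≤4 o)))
                 (ℕ.<-≤-trans j<3+e (ℕ.+-monoʳ-≤ 3 (depth≤4 o))))
      ((3<i+w , i<3+v) , (3<j+d , j<3+e))
  , refl

attached⇒spot : ∀ b c → Attached b c →
  ∃₂ λ d p → p ∈ spots (orientation b) × place b d p ≡ c
attached⇒spot b c (inj₂ above-b , share) = above , share⇒spot above b c above-b share
attached⇒spot b c (inj₁ below-b , share) = below , share⇒spot below b c lower share
  where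
  lower : z c ≡ level below (z b)
  lower = trans (sym (level-opposite above (z c))) (cong (λ h → h ℤ.- 1ℤ) (sym below-b))

-- Weights

-- Abstract, as Agda would otherwise unfold products by these numerals into
-- iterated sums.

abstract
  unit : ℕ
  unit = 1000000

  instance
    unit-nonZero : ℕ.NonZero unit
    unit-nonZero = _

  growth : ℕ
  growth = 180

  growth-nonZero : ℕ.NonZero growth
  growth-nonZero = _

  growth≡180 : growth ≡ 180
  growth≡180 = refl

-- weight ps / unit bounds the sum of (1 / 55) ^ |S| over the sets S of
-- pairwise non-overlapping spots in ps; the suc rounds up.  The first argument
-- of weigh is fuel, sufficient when at least length ps.

weigh : ℕ → List Spot → ℕ
weigh _       []       = unit
weigh zero    (_ ∷ _)  = unit
weigh (suc d) (p ∷ ps) = weigh d ps ℕ.+ suc (weigh d (clear p ps) ℕ./ 55)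

weight : List Spot → ℕ
weight ps = weigh (length ps) ps

-- `weight` takes the exact length as fuel, whereas `weigh` may reach `clear p ps` with fuel to
-- spare; their agreement lets the recursion be stated for `weight`.
weigh-irrelevant : ∀ d e ps → length ps ℕ.≤ d → length ps ℕ.≤ e → weigh d ps ≡ weigh e ps
weigh-irrelevant d       e       []       _         _         = refl
weigh-irrelevant (suc d) (suc e) (p ∷ ps) (s≤s n≤d) (s≤s n≤e) =
  cong₂ (λ v w → v ℕ.+ suc (w ℕ./ 55))
    (weigh-irrelevant d e ps n≤d n≤e)
    (weigh-irrelevant d e (clear p ps) (clear≤ n≤d) (clear≤ n≤e))
  where
  clear≤ : ∀ {m} → length ps ℕ.≤ m → length (clear p ps) ℕ.≤ m
  clear≤ = ℕ.≤-trans (length-filter (λ q → ¬? (meet? p q)) ps)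

n≤55*suc[n/55] : ∀ n → n ℕ.≤ 55 ℕ.* suc (n ℕ./ 55)
n≤55*suc[n/55] n = begin
  n                            ≡⟨ m≡m%n+[m/n]*n n 55 ⟩
  n ℕ.% 55 ℕ.+ n ℕ./ 55 ℕ.* 55   ≤⟨ ℕ.+-monoˡ-≤ _ (ℕ.<⇒≤ (m%n<n n 55)) ⟩
  55 ℕ.+ n ℕ./ 55 ℕ.* 55         ≡⟨ ℕ.*-comm (suc (n ℕ./ 55)) 55 ⟩
  55 ℕ.* suc (n ℕ./ 55)          ∎
  where open ℕ.≤-Reasoning

-- A set of non-overlapping spots either omits `p`, or contains it at a cost of 1 / 55 and otherwise
-- avoids all spots meeting `p`. Rounding up leaves an inequality.
weight-∷ : ∀ p ps →
  55 ℕ.* weight ps ℕ.+ weight (clear p ps) ℕ.≤ 55 ℕ.* weight (p ∷ ps)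
weight-∷ p ps = begin
  55 ℕ.* weight ps ℕ.+ weight (clear p ps)
    ≡⟨ cong (55 ℕ.* weight ps ℕ.+_) (weigh-irrelevant _ _ (clear p ps) ℕ.≤-refl
         (length-filter (λ q → ¬? (meet? p q)) ps)) ⟩
  55 ℕ.* weight ps ℕ.+ w
    ≤⟨ ℕ.+-monoʳ-≤ (55 ℕ.* weight ps) (n≤55*suc[n/55] w) ⟩
  55 ℕ.* weight ps ℕ.+ 55 ℕ.* suc (w ℕ./ 55)
    ≡⟨ sym (ℕ.*-distribˡ-+ 55 (weight ps) (suc (w ℕ./ 55))) ⟩
  55 ℕ.* weight (p ∷ ps) ∎
  where
  open ℕ.≤-Reasoning
  w : ℕ
  w = weigh (length ps) (clear p ps)

weight-tail : ∀ p ps → weight ps ℕ.≤ weight (p ∷ ps)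
weight-tail p ps = ℕ.m≤m+n (weight ps) _

-- `near≤` depends on the spot and is verified by evaluation for each of the 46 spots around a block
-- of either orientation. The coordinate bounds serve `place-parent`.
record Fair (o : Orientation) (p : Spot) : Set where
  constructor fair
  field
    col≤6  : col p ℕ.≤ 6
    row≤6  : row p ℕ.≤ 6
    near≤  : weight (near o p) ℕ.≤ 1605000
open Fair

fair? : ∀ o → Decidable (Fair o)
fair? o p = map′ (λ { (a , b , c) → fair a b c }) (λ { (fair a b c) → a , b , c })
  (col p ℕ.≤? 6 ×-dec row p ℕ.≤? 6 ×-dec weight (near o p) ℕ.≤? 1605000)

abstract
  spots-fair : ∀ o → All (Fair o) (spots o)
  spots-fair 2×4 = from-yes (All.all? (fair? 2×4) (spots 2×4))
  spots-fair 4×2 = from-yes (All.all? (fair? 4×2) (spots 4×2))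

  unit-budget : 55 ℕ.* (2003000 ℕ.* 1605000) ℕ.≤ growth ℕ.* (unit ℕ.* unit)
  unit-budget =
    from-yes (55 ℕ.* (2003000 ℕ.* 1605000) ℕ.≤? growth ℕ.* (unit ℕ.* unit))

  unit²-bound : 2003000 ℕ.* 2003000 ℕ.≤ 5 ℕ.* (unit ℕ.* unit)
  unit²-bound = from-yes (2003000 ℕ.* 2003000 ℕ.≤? 5 ℕ.* (unit ℕ.* unit))

  weight-spots : ∀ o → weight (spots o) ℕ.≤ 2003000
  weight-spots 2×4 = from-yes (weight (spots 2×4) ℕ.≤? 2003000)
  weight-spots 4×2 = from-yes (weight (spots 4×2) ℕ.≤? 2003000)

-- Exploration

infix 4 _∋_ _∋?_

_∋_ : ∀ {n} → ContiguousBuilding n → Block → Set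
A ∋ b = ∃ λ i → blocks A i ≡ b

_≟ᵒ_ : DecidableEquality Orientation
2×4 ≟ᵒ 2×4 = yes refl
2×4 ≟ᵒ 4×2 = no λ ()
4×2 ≟ᵒ 2×4 = no λ ()
4×2 ≟ᵒ 4×2 = yes refl

_≟ᵇ_ : DecidableEquality Block
block o x y z ≟ᵇ block o′ x′ y′ z′ =
  map′ (λ { (refl , refl , refl , refl) → refl }) (λ { refl → refl , refl , refl , refl })
    (o ≟ᵒ o′ ×-dec x ℤ.≟ x′ ×-dec y ℤ.≟ y′ ×-dec z ℤ.≟ z′)

open DecMembership _≟ᵇ_ using (_∈?_)

_∋?_ : ∀ {n} (A : ContiguousBuilding n) → Decidable (A ∋_)
A ∋? b = Fin.any? (λ i → blocks A i ≟ᵇ b)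

-- The reason why overlaps settle questions: a spot meeting a block known to be present can hold
-- only that block.
share⇒≡ : ∀ {n} (A : ContiguousBuilding n) {b c} → A ∋ b → A ∋ c →
          z b ≡ z c → ShareStud b c → b ≡ c
share⇒≡ A (i , refl) (j , refl) level share with i Fin.≟ j
... | yes refl = refl
... | no  i≢j  = contradiction (level , share) (disjoint A i j i≢j)

lookup-injective : ∀ {a} {X : Set a} {xs : List X} → Unique xs →
                   ∀ i j → lookup xs i ≡ lookup xs j → i ≡ j
lookup-injective (_ ∷ _)   Fin.zero    Fin.zero    _  = refl
lookup-injective (x∉ ∷ _)  Fin.zero    (Fin.suc j) eq =
  contradiction eq (All.lookup x∉ (∈-lookup j))
lookup-injective (x∉ ∷ _)  (Fin.suc i) Fin.zero    eq =
  contradiction (sym eq) (All.lookup x∉ (∈-lookup i))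
lookup-injective (_ ∷ xs!) (Fin.suc i) (Fin.suc j) eq =
  cong Fin.suc (lookup-injective xs! i j eq)

-- Pigeonhole: distinct blocks of `A` have distinct indices. This excludes a further discovery once
-- n blocks are known.
length≤size : ∀ {n} (A : ContiguousBuilding n) {F} → Unique F → All (A ∋_) F → length F ℕ.≤ n
length≤size A {F} F! F⊆A = Fin.injective⇒≤ {f = index} index-injective
  where
  entry : ∀ i → A ∋ lookup F i
  entry i = All.lookup F⊆A (∈-lookup i)
  index : Fin (length F) → Fin _
  index = proj₁ ∘ entry
  index-injective : ∀ {i j} → index i ≡ index j → i ≡ j
  index-injective {i} {j} eq = lookup-injective F! i j
    (trans (sym (proj₂ (entry i))) (trans (cong (blocks A) eq) (proj₂ (entry j))))

length-split : ∀ {a p} {X : Set a} {P : Pred X p} (P? : Decidable P) xs →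
  length xs ≡ length (filter (¬? ∘ P?) xs) ℕ.+ length (filter P? xs)
length-split P? []       = refl
length-split P? (x ∷ xs) with P? x
... | yes _ = trans (cong suc (length-split P? xs)) (sym (ℕ.+-suc _ _))
... | no  _ = cong suc (length-split P? xs)

-- The pending questions about the neighbours of owner on one side: rest lists
-- the spots at which an undiscovered block may still be.

record Item : Set where
  constructor item
  field
    owner : Block
    side  : Side
    rest  : List Spot
open Item

weights : List Item → ℕ
weights s = product (map (weight ∘ rest) s)

Legal : List Block → Item → Set
Legal F t = owner t ∈ F × All (Fair (orientation (owner t))) (rest t)

Offers : Block → Item → Set
Offers c t = Any (λ p → place (owner t) (side t) p ≡ c) (rest t)

-- The buildings that agree with the answers so far. Negative answers are not stored: a spot found
-- empty merely stops being offered, and `frontier` ensures that no neighbour is lost.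
record Explored {n} (F : List Block) (s : List Item) (A : ContiguousBuilding n) : Set where
  constructor explored
  field
    found    : All (A ∋_) F
    frontier : ∀ {b c} → b ∈ F → A ∋ c → Attached b c → c ∈ F ⊎ Any (Offers c) s
open Explored

_≇_ : ∀ {n} → ContiguousBuilding n → ContiguousBuilding n → Set
A ≇ B = ¬ A ≅ B

explored-⊆ : ∀ {n} {A : ContiguousBuilding n} {F s s′} →
  (∀ {c} → A ∋ c → Any (Offers c) s → c ∈ F ⊎ Any (Offers c) s′) →
  Explored F s A → Explored F s′ A
explored-⊆ keep (explored found frontier) = explored found λ b∈F A∋c att →
  [ inj₁ , keep A∋c ]′ (frontier b∈F A∋c att)

-- With nothing pending, `frontier` makes `F` closed under attachment within `A`, so a path starting
-- at `b` carries membership to every block.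
complete : ∀ {n} {A : ContiguousBuilding n} {F b c} → Explored F [] A →
           b ∈ F → A ∋ c → c ∈ F
complete {A = A} {F} {b} E b∈F (j , refl) =
  let i , eq = All.lookup (found E) b∈F
  in reach (contiguous A i j) (subst (_∈ F) (sym eq) b∈F)
  where
  reach : ∀ {i j} → Star (Attached on blocks A) i j → blocks A i ∈ F → blocks A j ∈ F
  reach Star.ε       i∈F = i∈F
  reach (att ◅ path) i∈F with frontier E i∈F (_ , refl) att
  ... | inj₁ k∈F = reach path k∈F
  ... | inj₂ ()

act-identity : ∀ b → act (translate 0ℤ 0ℤ 0ℤ) b ≡ b
act-identity (block o x y z) =
  block-cong (ℤ.+-identityʳ x) (ℤ.+-identityʳ y) (ℤ.+-identityʳ z)

-- A leaf of the decision tree determines the building: both consist of exactly the blocks of `F`,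
-- so the zero translation identifies them.
≅-complete : ∀ {n} {A B : ContiguousBuilding n} {F b} → b ∈ F →
             Explored F [] A → Explored F [] B → A ≅ B
≅-complete {A = A} {B} b∈F EA EB = translate 0ℤ 0ℤ 0ℤ
  , (λ i → let j , eq = All.lookup (found EB) (complete EA b∈F (i , refl))
           in j , trans (act-identity _) (sym eq))
  , (λ j → let i , eq = All.lookup (found EA) (complete EB b∈F (j , refl))
           in i , trans (act-identity _) eq)

sides : ∀ d e → e ≡ d ⊎ e ≡ opposite d
sides above above = inj₁ refl
sides above below = inj₂ refl
sides below above = inj₂ refl
sides below below = inj₁ refl

∈-clear : ∀ p {q ps} → q ∈ ps → ¬ Meet p q → q ∈ clear p ps
∈-clear p = ∈-filter⁺ (λ q → ¬? (meet? p q))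

-- What is pending once a block has been discovered at spot p of f: spots that
-- overlap a block known to be present are dropped.

branch : Block → Side → Spot → List Spot → List Item → List Item
branch f d p ps s =
    item b d (spots (facing p))
  ∷ item b (opposite d) (near (orientation f) p)
  ∷ item f d (clear p ps)
  ∷ s
  where
  b : Block
  b = place f d p

-- Serves two cases: after a negative answer the hypothesis is vacuous, and for a place already in
-- `F` no question is asked.
explored-absent : ∀ {n} {A : ContiguousBuilding n} {F f d p ps s} →
  (A ∋ place f d p → place f d p ∈ F) →
  Explored F (item f d (p ∷ ps) ∷ s) A → Explored F (item f d ps ∷ s) A
explored-absent {A = A} {F} {f} {d} {ps = ps} {s} known = explored-⊆ keep
  where
  keep : ∀ {c} → A ∋ c → Any (Offers c) _ → c ∈ F ⊎ Any (Offers c) (item f d ps ∷ s)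
  keep A∋c (here (here refl)) = inj₁ (known A∋c)
  keep A∋c (here (there q∈))  = inj₂ (here q∈)
  keep A∋c (there t∈)         = inj₂ (there t∈)

-- The two new items cover both sides of the new block, except for the parent. An old offer
-- disappears only if it meets `p`, and then it is the new block itself.
explored-present : ∀ {n} {A : ContiguousBuilding n} {F f d p ps s} →
  f ∈ F → Fair (orientation f) p → A ∋ place f d p →
  Explored F (item f d (p ∷ ps) ∷ s) A →
  Explored (place f d p ∷ F) (branch f d p ps s) A
explored-present {A = A} {F} {f} {d} {p} {ps} {s} f∈F p-fair A∋b (explored found frontier) =
  explored (A∋b ∷ found) frontier′
  where
  b : Block
  b = place f d p
  frontier′ : ∀ {b′ c} → b′ ∈ b ∷ F → A ∋ c → Attached b′ c →
              c ∈ b ∷ F ⊎ Any (Offers c) (branch f d p ps s)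
  frontier′ {c = c} (here refl) A∋c att with attached⇒spot b c att
  ... | e , q , q∈ , refl with sides d e
  ...   | inj₁ refl = inj₂ (here (lose q∈ refl))
  ...   | inj₂ refl with meet? (parent (orientation f) p) q
  ...     | no ¬meet = inj₂ (there (here (lose (∈-clear _ q∈ ¬meet) refl)))
  -- A neighbour overlapping the parent's spot is the parent, which is known.
  ...     | yes meet = inj₁ (there (subst (_∈ F) f≡c f∈F))
    where
    back : place b (opposite d) (parent (orientation f) p) ≡ f
    back = place-parent f d p (col≤6 p-fair) (row≤6 p-fair)
    f≡c : f ≡ place b (opposite d) q
    f≡c = share⇒≡ A (All.lookup found f∈F) A∋c (sym (level-opposite d (z f)))
            (subst (λ g → ShareStud g (place b (opposite d) q)) back
              (meet⇒share b (opposite d) (parent (orientation f) p) q meet))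
  frontier′ {c = c} (there b′∈F) A∋c att with frontier b′∈F A∋c att
  ... | inj₁ c∈F                 = inj₁ (there c∈F)
  ... | inj₂ (there t∈)          = inj₂ (there (there (there t∈)))
  ... | inj₂ (here (here refl))  = inj₁ (here refl)
  ... | inj₂ (here (there q∈′)) with find q∈′
  ...   | q , q∈ , refl with meet? p q
  ...     | no ¬meet = inj₂ (there (there (here (lose (∈-clear p q∈ ¬meet) refl))))
  ...     | yes meet = inj₁ (here (sym (share⇒≡ A A∋b A∋c refl (meet⇒share f d p q meet))))

-- The counting induction

-- The two items of a new block contribute U² on the left and v₁ v₂ on the right. The budget
-- replaces 55 v₁ v₂ by growth U², and cancelling U² leaves one factor `growth` for the block.
branch-arith : ∀ U X W K y v₁ v₂ v₃ .{{_ : ℕ.NonZero U}} →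
  55 ℕ.* (v₁ ℕ.* v₂) ℕ.≤ growth ℕ.* (U ℕ.* U) →
  y ℕ.* (U ℕ.* (U ℕ.* (U ℕ.* X))) ℕ.≤ K ℕ.* (v₁ ℕ.* (v₂ ℕ.* (v₃ ℕ.* W))) →
  55 ℕ.* (y ℕ.* (U ℕ.* X)) ℕ.≤ growth ℕ.* K ℕ.* (v₃ ℕ.* W)
branch-arith U X W K y v₁ v₂ v₃ v≤ h = ℕ.*-cancelʳ-≤ _ _ (U ℕ.* U) {{ℕ.m*n≢0 U U}} (begin
  55 ℕ.* (y ℕ.* (U ℕ.* X)) ℕ.* (U ℕ.* U)
    ≡⟨ solve 3 (λ U X y → con 55 :* (y :* (U :* X)) :* (U :* U)
                        := con 55 :* (y :* (U :* (U :* (U :* X))))) refl U X y ⟩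
  55 ℕ.* (y ℕ.* (U ℕ.* (U ℕ.* (U ℕ.* X))))
    ≤⟨ ℕ.*-monoʳ-≤ 55 h ⟩
  55 ℕ.* (K ℕ.* (v₁ ℕ.* (v₂ ℕ.* (v₃ ℕ.* W))))
    ≡⟨ solve 5 (λ K v₁ v₂ v₃ W → con 55 :* (K :* (v₁ :* (v₂ :* (v₃ :* W))))
                              := con 55 :* (v₁ :* v₂) :* (K :* (v₃ :* W))) refl K v₁ v₂ v₃ W ⟩
  55 ℕ.* (v₁ ℕ.* v₂) ℕ.* (K ℕ.* (v₃ ℕ.* W))
    ≤⟨ ℕ.*-monoˡ-≤ (K ℕ.* (v₃ ℕ.* W)) v≤ ⟩
  growth ℕ.* (U ℕ.* U) ℕ.* (K ℕ.* (v₃ ℕ.* W))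
    ≡⟨ solve 5 (λ g U K v₃ W → g :* (U :* U) :* (K :* (v₃ :* W))
                            := g :* K :* (v₃ :* W) :* (U :* U)) refl growth U K v₃ W ⟩
  growth ℕ.* K ℕ.* (v₃ ℕ.* W) ℕ.* (U ℕ.* U) ∎)
  where
  open ℕ.≤-Reasoning
  open ℕSolver.+-*-Solver

-- The two answers to one question: a buildings lack the block, y have it. The factor 55 on y
-- matches the discount in `weight-∷`.
join-arith : ∀ a y X K w v v₃ W →
  55 ℕ.* w ℕ.+ v₃ ℕ.≤ 55 ℕ.* v →
  a ℕ.* X ℕ.≤ K ℕ.* (w ℕ.* W) →
  55 ℕ.* (y ℕ.* X) ℕ.≤ K ℕ.* (v₃ ℕ.* W) →
  (a ℕ.+ y) ℕ.* X ℕ.≤ K ℕ.* (v ℕ.* W)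
join-arith a y X K w v v₃ W v≤ ha hy = ℕ.*-cancelˡ-≤ 55 (begin
  55 ℕ.* ((a ℕ.+ y) ℕ.* X)
    ≡⟨ solve 3 (λ a y X → con 55 :* ((a :+ y) :* X)
                        := con 55 :* (a :* X) :+ con 55 :* (y :* X)) refl a y X ⟩
  55 ℕ.* (a ℕ.* X) ℕ.+ 55 ℕ.* (y ℕ.* X)
    ≤⟨ ℕ.+-mono-≤ (ℕ.*-monoʳ-≤ 55 ha) hy ⟩
  55 ℕ.* (K ℕ.* (w ℕ.* W)) ℕ.+ K ℕ.* (v₃ ℕ.* W)
    ≡⟨ solve 4 (λ K w v₃ W → con 55 :* (K :* (w :* W)) :+ K :* (v₃ :* W)
                          := K :* ((con 55 :* w :+ v₃) :* W)) refl K w v₃ W ⟩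
  K ℕ.* ((55 ℕ.* w ℕ.+ v₃) ℕ.* W)
    ≤⟨ ℕ.*-monoʳ-≤ K (ℕ.*-monoˡ-≤ W v≤) ⟩
  K ℕ.* (55 ℕ.* v ℕ.* W)
    ≡⟨ solve 3 (λ K v W → K :* (con 55 :* v :* W) := con 55 :* (K :* (v :* W))) refl K v W ⟩
  55 ℕ.* (K ℕ.* (v ℕ.* W)) ∎)
  where
  open ℕ.≤-Reasoning
  open ℕSolver.+-*-Solver

clear-⊆ : ∀ {ℓ} {P : Pred Spot ℓ} p {ps} → All P ps → All P (clear p ps)
clear-⊆ p = All.filter⁺ (λ q → ¬? (meet? p q))

-- Here k is the number of blocks yet to be discovered.

Bound : ℕ → ℕ → List Block → List Item → Set
Bound n k F s = ∀ (L : List (ContiguousBuilding n)) →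
  AllPairs _≇_ L → All (Explored F s) L →
  length L ℕ.* unit ℕ.^ length s ℕ.≤ growth ℕ.^ k ℕ.* weights s

mutual
  -- A positive answer lengthens `s` but lowers `k`, so the recursion is on `k` first and then on
  -- the pending items and their spots. At a leaf, two listed buildings would be identified, so at
  -- most one remains.
  count : ∀ k s {n F r} → r ∈ F → Unique F → length F ℕ.+ k ≡ n → All (Legal F) s →
          Bound n k F s
  count k [] r∈F F! size [] []          _ _ = z≤n
  count k [] r∈F F! size [] (_ ∷ [])    _ _ =
    ℕ.≤-trans (ℕ.m^n>0 growth {{growth-nonZero}} k) (ℕ.≤-reflexive (sym (ℕ.*-identityʳ _)))
  count k [] r∈F F! size [] (A ∷ B ∷ _) ((A≇B ∷ _) ∷ _) (EA ∷ EB ∷ _) =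
    contradiction (≅-complete {A = A} {B} r∈F EA EB) A≇B
  count k (item f d ps ∷ s) r∈F F! size ((f∈F , ps-fair) ∷ legal) =
    sweep k s ps f d f∈F F! size ps-fair legal

  -- Each question splits `L` by its answer, and `join-arith` adds the two counts. An exhausted item
  -- weighs exactly `unit` and puts the same factor on both sides.
  sweep : ∀ k s ps f d {n F} → f ∈ F → Unique F → length F ℕ.+ k ≡ n →
          All (Fair (orientation f)) ps → All (Legal F) s →
          Bound n k F (item f d ps ∷ s)
  sweep k s [] f d {F = F} f∈F F! size [] legal L L! EL = begin
    length L ℕ.* (unit ℕ.* X)        ≡⟨ swap (length L) unit X ⟩
    unit ℕ.* (length L ℕ.* X)        ≤⟨ ℕ.*-monoʳ-≤ unit
      (count k s f∈F F! size legal L L! (All.map (λ {A} → finished A) EL)) ⟩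
    unit ℕ.* (growth ℕ.^ k ℕ.* weights s)  ≡⟨ sym (swap (growth ℕ.^ k) unit (weights s)) ⟩
    growth ℕ.^ k ℕ.* (unit ℕ.* weights s)  ∎
    where
    open ℕ.≤-Reasoning
    X : ℕ
    X = unit ℕ.^ length s
    swap : ∀ a b c → a ℕ.* (b ℕ.* c) ≡ b ℕ.* (a ℕ.* c)
    swap = solve 3 (λ a b c → a :* (b :* c) := b :* (a :* c)) refl
      where open ℕSolver.+-*-Solver
    finished : ∀ A → Explored F (item f d [] ∷ s) A → Explored F s A
    finished A = explored-⊆ λ { _ (here ()) ; _ (there t∈) → inj₂ t∈ }
  sweep k s (p ∷ ps) f d {n} {F} f∈F F! size (p-fair ∷ ps-fair) legal L L! EL
    with place f d p ∈? F
  ... | yes b∈F = ℕ.≤-trans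
          (sweep k s ps f d f∈F F! size ps-fair legal L L!
            (All.map (explored-absent (λ _ → b∈F)) EL))
          (ℕ.*-monoʳ-≤ (growth ℕ.^ k) (ℕ.*-monoˡ-≤ (weights s) (weight-tail p ps)))
  ... | no  b∉F = begin
          length L ℕ.* X                      ≡⟨ cong (ℕ._* X) (length-split has? L) ⟩
          (length L₀ ℕ.+ length L₁) ℕ.* X     ≤⟨ join-arith (length L₀) (length L₁) X
            (growth ℕ.^ k) (weight ps) (weight (p ∷ ps)) (weight (clear p ps)) (weights s)
            (weight-∷ p ps)
            (sweep k s ps f d f∈F F! size ps-fair legal L₀ (AllPairs.filter⁺ _ L!)
              (All.zipWith (λ { (E , ∌b) → explored-absent (⊥-elim ∘ ∌b) E })
                (All.filter⁺ _ EL , All.all-filter (¬? ∘ has?) L)))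
            (present k s p ps f d f∈F F! size b∉F p-fair ps-fair legal
              L₁ (AllPairs.filter⁺ has? L!) (All.all-filter has? L) (All.filter⁺ has? EL)) ⟩
          growth ℕ.^ k ℕ.* (weight (p ∷ ps) ℕ.* weights s) ∎
    where
    open ℕ.≤-Reasoning
    X : ℕ
    X = unit ℕ.^ suc (length s)
    has? : Decidable (_∋ place f d p)
    has? A = A ∋? place f d p
    L₀ L₁ : List (ContiguousBuilding n)
    L₀ = filter (¬? ∘ has?) L
    L₁ = filter has? L

  -- The leading 55 is the reciprocal of the weight given to the discovered block.
  present : ∀ k s p ps f d {n F} → f ∈ F → Unique F → length F ℕ.+ k ≡ n →
    place f d p ∉ F → Fair (orientation f) p → All (Fair (orientation f)) ps →
    All (Legal F) s → (L : List (ContiguousBuilding n)) → AllPairs _≇_ L →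
    All (_∋ place f d p) L → All (Explored F (item f d (p ∷ ps) ∷ s)) L →
    55 ℕ.* (length L ℕ.* unit ℕ.^ suc (length s)) ℕ.≤
    growth ℕ.^ k ℕ.* (weight (clear p ps) ℕ.* weights s)
  present zero s p ps f d f∈F F! size b∉F p-fair ps-fair legal [] _ _ _ = z≤n
  -- All n blocks are already in `F`, so no building can contain a new one.
  present zero s p ps f d {n} {F} f∈F F! size b∉F p-fair ps-fair legal
          (A ∷ _) _ (A∋b ∷ _) (E ∷ _) =
    contradiction
      (ℕ.≤-trans (length≤size A (All.¬Any⇒All¬ F b∉F ∷ F!) (A∋b ∷ found E))
                 (ℕ.≤-reflexive (trans (sym size) (ℕ.+-identityʳ (length F)))))
      (ℕ.<-irrefl refl)
  present (suc k) s p ps f d {n} {F} f∈F F! size b∉F p-fair ps-fair legal L L! L∋b EL =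
    branch-arith unit (unit ℕ.^ length s) (weights s) (growth ℕ.^ k) (length L)
      (weight (spots (facing p))) (weight (near (orientation f) p)) (weight (clear p ps))
      budget
      (count k (branch f d p ps s) (here refl) (All.¬Any⇒All¬ F b∉F ∷ F!)
        (trans (sym (ℕ.+-suc (length F) k)) size)
        ((here refl , spots-fair (facing p))
         ∷ (here refl , clear-⊆ (parent (orientation f) p) (spots-fair (facing p)))
         ∷ (there f∈F , clear-⊆ p ps-fair)
         ∷ All.map (λ { (o∈F , fairs) → there o∈F , fairs }) legal)
        L L!
        (All.zipWith (λ { (A∋b , E) → explored-present f∈F p-fair A∋b E }) (L∋b , EL)))
    where
    open ℕ.≤-Reasoning
    budget : 55 ℕ.* (weight (spots (facing p)) ℕ.* weight (near (orientation f) p)) ℕ.≤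
             growth ℕ.* (unit ℕ.* unit)
    budget = begin
      55 ℕ.* (weight (spots (facing p)) ℕ.* weight (near (orientation f) p))
        ≤⟨ ℕ.*-monoʳ-≤ 55 (ℕ.*-mono-≤ (weight-spots (facing p)) (near≤ p-fair)) ⟩
      55 ℕ.* (2003000 ℕ.* 1605000)
        ≤⟨ unit-budget ⟩
      growth ℕ.* (unit ℕ.* unit) ∎

-- Buildings with a block at the origin

origin : Orientation → Block
origin o = block o 0ℤ 0ℤ 0ℤ

start : Orientation → List Item
start o = item (origin o) above (spots o) ∷ item (origin o) below (spots o) ∷ []

explored-start : ∀ {n} {A : ContiguousBuilding n} o → A ∋ origin o →
                 Explored (origin o ∷ []) (start o) A
explored-start {A = A} o A∋o = explored (A∋o ∷ []) frontier′
  where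
  frontier′ : ∀ {b c} → b ∈ origin o ∷ [] → A ∋ c → Attached b c →
              c ∈ origin o ∷ [] ⊎ Any (Offers c) (start o)
  frontier′ {c = c} (here refl) _ att with attached⇒spot (origin o) c att
  ... | above , _ , q∈ , refl = inj₂ (here (lose q∈ refl))
  ... | below , _ , q∈ , refl = inj₂ (there (here (lose q∈ refl)))

-- The first block has no parent, so both of its sides carry the full weight; the constant 5 rounds
-- up 2.003² = 4.012.
count-origin : ∀ {n} o (L : List (ContiguousBuilding (suc n))) → AllPairs _≇_ L →
               All (_∋ origin o) L → length L ℕ.≤ 5 ℕ.* growth ℕ.^ n
count-origin {n} o L L! L∋o = cancel unit (weight (spots o)) (growth ℕ.^ n)
  (ℕ.≤-trans (ℕ.*-mono-≤ (weight-spots o) (weight-spots o)) unit²-bound)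
  (count n (start o) (here refl) ([] ∷ []) refl
    ((here refl , spots-fair o) ∷ (here refl , spots-fair o) ∷ [])
    L L! (All.map (λ {A} → explored-start {A = A} o) L∋o))
  where
  cancel : ∀ U v K .{{_ : ℕ.NonZero U}} → v ℕ.* v ℕ.≤ 5 ℕ.* (U ℕ.* U) →
    length L ℕ.* (U ℕ.* (U ℕ.* 1)) ℕ.≤ K ℕ.* (v ℕ.* (v ℕ.* 1)) → length L ℕ.≤ 5 ℕ.* K
  cancel U v K v²≤ h = ℕ.*-cancelʳ-≤ _ _ (U ℕ.* U) {{ℕ.m*n≢0 U U}} (begin
    length L ℕ.* (U ℕ.* U)
      ≡⟨ solve 2 (λ l U → l :* (U :* U) := l :* (U :* (U :* con 1))) refl (length L) U ⟩
    length L ℕ.* (U ℕ.* (U ℕ.* 1))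
      ≤⟨ h ⟩
    K ℕ.* (v ℕ.* (v ℕ.* 1))
      ≡⟨ solve 2 (λ K v → K :* (v :* (v :* con 1)) := K :* (v :* v)) refl K v ⟩
    K ℕ.* (v ℕ.* v)
      ≤⟨ ℕ.*-monoʳ-≤ K v²≤ ⟩
    K ℕ.* (5 ℕ.* (U ℕ.* U))
      ≡⟨ solve 2 (λ K U → K :* (con 5 :* (U :* U)) := con 5 :* K :* (U :* U)) refl K U ⟩
    5 ℕ.* K ℕ.* (U ℕ.* U) ∎)
    where
    open ℕ.≤-Reasoning
    open ℕSolver.+-*-Solver

-- Translation to the origin and the bound on T

add-add : ∀ x w a → x ℤ.+ w ℤ.+ a ≡ x ℤ.+ a ℤ.+ w
add-add = solve 3 (λ x w a → x :+ w :+ a := x :+ a :+ w) refl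
  where open +-*-Solver

add-sub : ∀ x a → x ℤ.+ a ℤ.+ ℤ.- a ≡ x
add-sub = solve 2 (λ x a → x :+ a :+ (:- a) := x) refl
  where open +-*-Solver

share-translate : ∀ a b c p q → ShareStud p q →
  ShareStud (act (translate a b c) p) (act (translate a b c) q)
share-translate a b c p q (i , j , p∋ , q∋) =
  i ℤ.+ a , j ℤ.+ b , covers-translate p p∋ , covers-translate q q∋
  where
  covers-translate : ∀ p → Covers p i j →
                     Covers (act (translate a b c) p) (i ℤ.+ a) (j ℤ.+ b)
  covers-translate (block o x y _) ((x≤i , i<) , (y≤j , j<)) =
    (ℤ.+-monoˡ-≤ a x≤i , subst (λ e → i ℤ.+ a ℤ.< e) (add-add x _ a) (ℤ.+-monoˡ-< a i<)) ,
    (ℤ.+-monoˡ-≤ b y≤j , subst (λ e → j ℤ.+ b ℤ.< e) (add-add y _ b) (ℤ.+-monoˡ-< b j<))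

translate-inverse : ∀ a b c p →
  act (translate (ℤ.- a) (ℤ.- b) (ℤ.- c)) (act (translate a b c) p) ≡ p
translate-inverse a b c (block o x y z) =
  block-cong (add-sub x a) (add-sub y b) (add-sub z c)

translated : ∀ {n} (a b c : ℤ) → ContiguousBuilding n → ContiguousBuilding n
translated a b c A = record
  { blocks     = act (translate a b c) ∘ blocks A
  ; disjoint   = λ i j i≢j (level , share) → disjoint A i j i≢j
      ( trans (sym (add-sub _ c)) (trans (cong (λ h → h ℤ.+ ℤ.- c) level) (add-sub _ c))
      , subst₂ ShareStud (translate-inverse a b c (blocks A i))
                         (translate-inverse a b c (blocks A j))
          (share-translate (ℤ.- a) (ℤ.- b) (ℤ.- c)
            (act (translate a b c) (blocks A i)) (act (translate a b c) (blocks A j)) share) )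
  ; contiguous = λ i j → Star.map attached (contiguous A i j)
  }
  where
  attached : ∀ {i j} → Attached (blocks A i) (blocks A j) →
    Attached (act (translate a b c) (blocks A i)) (act (translate a b c) (blocks A j))
  attached {i} {j} (inj₁ eq , share) =
    inj₁ (trans (cong (λ h → h ℤ.+ c) eq) (add-add (z (blocks A j)) 1ℤ c)) ,
    share-translate a b c (blocks A i) (blocks A j) share
  attached {i} {j} (inj₂ eq , share) =
    inj₂ (trans (cong (λ h → h ℤ.+ c) eq) (add-add (z (blocks A i)) 1ℤ c)) ,
    share-translate a b c (blocks A i) (blocks A j) share

-- Only a translation is used, so the orientation of the first block is kept. This is why the final
-- count has two classes, of at most 5 * growth ^ n buildings each.
centred : ∀ {n} → ContiguousBuilding (suc n) → ContiguousBuilding (suc n)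
centred A = translated (ℤ.- x b) (ℤ.- y b) (ℤ.- z b) A
  where
  b : Block
  b = blocks A Fin.zero

≅-centred : ∀ {n} (A : ContiguousBuilding (suc n)) → A ≅ centred A
≅-centred A = translate _ _ _ , (λ i → i , refl) , (λ i → i , refl)

centred-origin : ∀ {n} (A : ContiguousBuilding (suc n)) →
                 centred A ∋ origin (orientation (blocks A Fin.zero))
centred-origin A = Fin.zero
  , block-cong (ℤ.+-inverseʳ (x b)) (ℤ.+-inverseʳ (y b)) (ℤ.+-inverseʳ (z b))
  where
  b : Block
  b = blocks A Fin.zero

centred-injective : ∀ {n} (A B : ContiguousBuilding (suc n)) → centred A ≅ centred B → A ≅ B
centred-injective {n} A B eq =
  trans≅ {A} {centred A} {B} (≅-centred A)
    (trans≅ {centred A} {centred B} {B} eq (sym≅ {B} {centred B} (≅-centred B)))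
  where
  open Setoid (Buildings (suc n)) renaming (trans to trans≅; sym to sym≅)

T≤10*growth^n : ∀ T → CountsBuildings T → ∀ n → T (suc n) ℕ.≤ 10 ℕ.* growth ℕ.^ n
T≤10*growth^n T counts n = begin
  T (suc n)              ≡⟨ sym (length-tabulate nth) ⟩
  length L               ≡⟨ length-split has? L ⟩
  length (filter (¬? ∘ has?) L) ℕ.+ length (filter has? L)
    ≤⟨ ℕ.+-mono-≤
         (count-origin 4×2 _ (AllPairs.filter⁺ _ L!)
           (All.zipWith (λ { (o∈ , ∌2×4) → [ ⊥-elim ∘ ∌2×4 , id ]′ o∈ })
             (All.filter⁺ (¬? ∘ has?) {xs = L} L∋ , All.all-filter (¬? ∘ has?) L)))
         (count-origin 2×4 _ (AllPairs.filter⁺ has? L!) (All.all-filter has? L)) ⟩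
  5 ℕ.* K ℕ.+ 5 ℕ.* K    ≡⟨ sym (ℕ.*-distribʳ-+ K 5 5) ⟩
  10 ℕ.* K               ∎
  where
  open ℕ.≤-Reasoning
  open Bijection (counts (suc n)) using (to; injective)
  K : ℕ
  K = growth ℕ.^ n
  nth : Fin (T (suc n)) → ContiguousBuilding (suc n)
  nth = centred ∘ to
  L : List (ContiguousBuilding (suc n))
  L = tabulate nth
  L! : AllPairs _≇_ L
  L! = AllPairs.tabulate⁺ λ {i} {j} i≢j eq →
         i≢j (injective (centred-injective (to i) (to j) eq))
  has? : Decidable (_∋ origin 2×4)
  has? A = A ∋? origin 2×4
  either : ∀ o {A : ContiguousBuilding (suc n)} →
           A ∋ origin o → A ∋ origin 2×4 ⊎ A ∋ origin 4×2
  either 2×4 = inj₁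
  either 4×2 = inj₂
  L∋ : All (λ A → A ∋ origin 2×4 ⊎ A ∋ origin 4×2) L
  L∋ = All.tabulate⁺ λ i →
    either (orientation (blocks (to i) Fin.zero)) {nth i} (centred-origin (to i))

-- Rational exponentials

*-monoˡ : ∀ {p q r} → 0ℚ ℚ.≤ r → p ℚ.≤ q → r ℚ.* p ℚ.≤ r ℚ.* q
*-monoˡ {r = r} 0≤r = ℚ.*-monoˡ-≤-nonNeg r {{ℚ.nonNegative 0≤r}}

*-monoʳ : ∀ {p q r} → 0ℚ ℚ.≤ r → p ℚ.≤ q → p ℚ.* r ℚ.≤ q ℚ.* r
*-monoʳ {r = r} 0≤r = ℚ.*-monoʳ-≤-nonNeg r {{ℚ.nonNegative 0≤r}}

*-nonNeg : ∀ {p q} → 0ℚ ℚ.≤ p → 0ℚ ℚ.≤ q → 0ℚ ℚ.≤ p ℚ.* q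
*-nonNeg {p} {q} 0≤p 0≤q = subst (ℚ._≤ p ℚ.* q) (ℚ.*-zeroʳ p) (*-monoˡ 0≤p 0≤q)

^-nonNeg : ∀ {p} n → 0ℚ ℚ.≤ p → 0ℚ ℚ.≤ p ^ n
^-nonNeg zero    _   = from-yes (0ℚ ℚ.≤? 1ℚ)
^-nonNeg (suc n) 0≤p = *-nonNeg 0≤p (^-nonNeg n 0≤p)

^-mono-≤ : ∀ {p q} n → 0ℚ ℚ.≤ p → p ℚ.≤ q → p ^ n ℚ.≤ q ^ n
^-mono-≤ zero    _   _   = ℚ.≤-refl
^-mono-≤ (suc n) 0≤p p≤q = ℚ.≤-trans
  (*-monoʳ (^-nonNeg n 0≤p) p≤q)
  (*-monoˡ (ℚ.≤-trans 0≤p p≤q) (^-mono-≤ n 0≤p p≤q))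

^-pos : ∀ {p} n → 0ℚ ℚ.< p → 0ℚ ℚ.< p ^ n
^-pos     zero    _   = from-yes (0ℚ ℚ.<? 1ℚ)
^-pos {p} (suc n) 0<p = subst (ℚ._< p ^ suc n) (ℚ.*-zeroʳ p)
  (ℚ.*-monoʳ-<-pos p {{ℚ.positive 0<p}} (^-pos n 0<p))

^-cancel-≤ : ∀ {p q} n → 0ℚ ℚ.≤ q → p ^ suc n ℚ.≤ q ^ suc n → p ℚ.≤ q
^-cancel-≤ {p} {q} n 0≤q pⁿ≤qⁿ = ℚ.≮⇒≥ λ q<p →
  ℚ.<-irrefl refl (begin-strict
    q ^ suc n      ≤⟨ *-monoˡ 0≤q (^-mono-≤ n 0≤q (ℚ.<⇒≤ q<p)) ⟩
    q ℚ.* p ^ n    <⟨ ℚ.*-monoˡ-<-pos (p ^ n) {{ℚ.positive (^-pos n (ℚ.≤-<-trans 0≤q q<p))}} q<p ⟩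
    p ^ suc n      ≤⟨ pⁿ≤qⁿ ⟩
    q ^ suc n      ∎)
  where open ℚ.≤-Reasoning

1^n≡1 : ∀ n → 1ℚ ^ n ≡ 1ℚ
1^n≡1 zero    = refl
1^n≡1 (suc n) = trans (ℚ.*-identityˡ _) (1^n≡1 n)

-- Naturals and unit fractions as rationals

fromℚᵘ-+ : ∀ p q → ℚ.fromℚᵘ p ℚ.+ ℚ.fromℚᵘ q ≡ ℚ.fromℚᵘ (p ℚᵘ.+ q)
fromℚᵘ-+ p q = ℚ.toℚᵘ-injective (begin
  ℚ.toℚᵘ (ℚ.fromℚᵘ p ℚ.+ ℚ.fromℚᵘ q)               ≈⟨ ℚ.toℚᵘ-homo-+ (ℚ.fromℚᵘ p) (ℚ.fromℚᵘ q) ⟩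
  ℚ.toℚᵘ (ℚ.fromℚᵘ p) ℚᵘ.+ ℚ.toℚᵘ (ℚ.fromℚᵘ q)     ≈⟨ ℚᵘ.+-cong (ℚ.toℚᵘ-fromℚᵘ p) (ℚ.toℚᵘ-fromℚᵘ q) ⟩
  p ℚᵘ.+ q                                         ≈⟨ ℚᵘ.≃-sym (ℚ.toℚᵘ-fromℚᵘ (p ℚᵘ.+ q)) ⟩
  ℚ.toℚᵘ (ℚ.fromℚᵘ (p ℚᵘ.+ q))                     ∎)
  where open ℚᵘ.≃-Reasoning

fromℚᵘ-* : ∀ p q → ℚ.fromℚᵘ p ℚ.* ℚ.fromℚᵘ q ≡ ℚ.fromℚᵘ (p ℚᵘ.* q)
fromℚᵘ-* p q = ℚ.toℚᵘ-injective (begin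
  ℚ.toℚᵘ (ℚ.fromℚᵘ p ℚ.* ℚ.fromℚᵘ q)               ≈⟨ ℚ.toℚᵘ-homo-* (ℚ.fromℚᵘ p) (ℚ.fromℚᵘ q) ⟩
  ℚ.toℚᵘ (ℚ.fromℚᵘ p) ℚᵘ.* ℚ.toℚᵘ (ℚ.fromℚᵘ q)     ≈⟨ ℚᵘ.*-cong (ℚ.toℚᵘ-fromℚᵘ p) (ℚ.toℚᵘ-fromℚᵘ q) ⟩
  p ℚᵘ.* q                                         ≈⟨ ℚᵘ.≃-sym (ℚ.toℚᵘ-fromℚᵘ (p ℚᵘ.* q)) ⟩
  ℚ.toℚᵘ (ℚ.fromℚᵘ (p ℚᵘ.* q))                     ∎)
  where open ℚᵘ.≃-Reasoning

fromℚᵘ-mono-≤ : ∀ {p q} → p ℚᵘ.≤ q → ℚ.fromℚᵘ p ℚ.≤ ℚ.fromℚᵘ q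
fromℚᵘ-mono-≤ {p} {q} p≤q = ℚ.toℚᵘ-cancel-≤
  (ℚᵘ.≤-respˡ-≃ (ℚᵘ.≃-sym (ℚ.toℚᵘ-fromℚᵘ p)) (ℚᵘ.≤-respʳ-≃ (ℚᵘ.≃-sym (ℚ.toℚᵘ-fromℚᵘ q)) p≤q))

ι : ℕ → ℚ
ι n = + n ℚ./ 1

ι-suc : ∀ n → ι (suc n) ≡ 1ℚ ℚ.+ ι n
ι-suc n = sym (trans (fromℚᵘ-+ (mkℚᵘ 1ℤ 0) (mkℚᵘ (+ n) 0)) (ℚ.fromℚᵘ-cong
  {mkℚᵘ 1ℤ 0 ℚᵘ.+ mkℚᵘ (+ n) 0} {mkℚᵘ (+ suc n) 0} (ℚᵘ.*≡*
  (cong (λ e → (1ℤ ℤ.+ e) ℤ.* 1ℤ) (ℤ.*-identityʳ (+ n))))))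

ι-* : ∀ m n → ι (m ℕ.* n) ≡ ι m ℚ.* ι n
ι-* m n = sym (trans (fromℚᵘ-* (mkℚᵘ (+ m) 0) (mkℚᵘ (+ n) 0)) (ℚ.fromℚᵘ-cong
  {mkℚᵘ (+ m) 0 ℚᵘ.* mkℚᵘ (+ n) 0} {mkℚᵘ (+ (m ℕ.* n)) 0} (ℚᵘ.*≡*
  (cong (ℤ._* 1ℤ) (sym (ℤ.pos-* m n))))))

ι-^ : ∀ m n → ι (m ℕ.^ n) ≡ ι m ^ n
ι-^ m zero    = refl
ι-^ m (suc n) = trans (ι-* m (m ℕ.^ n)) (cong (ι m ℚ.*_) (ι-^ m n))

ι-mono-≤ : ∀ {m n} → m ℕ.≤ n → ι m ℚ.≤ ι n
ι-mono-≤ {m} {n} m≤n = fromℚᵘ-mono-≤ {mkℚᵘ (+ m) 0} {mkℚᵘ (+ n) 0}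
  (ℚᵘ.*≤* (ℤ.*-monoʳ-≤-nonNeg 1ℤ (ℤ.+≤+ m≤n)))

1/suc : ℕ → ℚ
1/suc n = + 1 ℚ./ suc n

ι*1/suc : ∀ n → ι (suc n) ℚ.* 1/suc n ≡ 1ℚ
ι*1/suc n = trans (fromℚᵘ-* (mkℚᵘ (+ suc n) 0) (mkℚᵘ 1ℤ n)) (ℚ.fromℚᵘ-cong
  {mkℚᵘ (+ suc n) 0 ℚᵘ.* mkℚᵘ 1ℤ n} {mkℚᵘ 1ℤ 0} (ℚᵘ.*≡* eq))
  where
  eq : (+ suc n ℤ.* 1ℤ) ℤ.* 1ℤ ≡ 1ℤ ℤ.* + (1 ℕ.* suc n)
  eq = trans (ℤ.*-identityʳ (+ suc n ℤ.* 1ℤ)) (trans (ℤ.*-identityʳ (+ suc n))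
    (sym (trans (ℤ.*-identityˡ _) (cong +_ (ℕ.*-identityˡ (suc n))))))

1/suc-* : ∀ m n → 1/suc m ℚ.* 1/suc n ≡ 1/suc (n ℕ.+ m ℕ.* suc n)
1/suc-* m n = fromℚᵘ-* (mkℚᵘ 1ℤ m) (mkℚᵘ 1ℤ n)

0<1/suc : ∀ n → 0ℚ ℚ.< 1/suc n
0<1/suc n = ℚ.positive⁻¹ _ {{ℚ.normalize-pos 1 (suc n)}}

0≤ι : ∀ n → 0ℚ ℚ.≤ ι n
0≤ι n = ι-mono-≤ {0} {n} z≤n

0≤1/suc : ∀ n → 0ℚ ℚ.≤ 1/suc n
0≤1/suc n = ℚ.<⇒≤ (0<1/suc n)

-- A fraction is at most the absolute value of its numerator.
archimedean : ∀ C → ∃ λ n → C ℚ.≤ ι n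
archimedean C@(mkℚ _ _ _) = ℤ.∣ ℚ.↥ C ∣ , ℚ.≤-trans (ℚ.≤-reflexive (sym (ℚ.fromℚᵘ-toℚᵘ C)))
  (fromℚᵘ-mono-≤ {ℚ.toℚᵘ C} {mkℚᵘ (+ ℤ.∣ ℚ.↥ C ∣) 0} (ℚᵘ.*≤* (bound (ℚ.↥ C) (ℚ.↧ₙ C))))
  where
  bound : ∀ i d .{{_ : ℕ.NonZero d}} → i ℤ.* 1ℤ ℤ.≤ + ℤ.∣ i ∣ ℤ.* + d
  bound (+ n) d = subst₂ ℤ._≤_ (sym (ℤ.*-identityʳ (+ n))) (ℤ.pos-* n d)
    (ℤ.+≤+ (ℕ.m≤m*n n d))
  bound (ℤ.-[1+ n ]) (suc d) = ℤ.-≤+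

eventually-half : ∀ C → ∃ λ m₀ → ∀ m → m₀ ℕ.≤ m → C ℚ.* 1/suc m ℚ.≤ ½
eventually-half C with archimedean C
... | n , C≤n = 2 ℕ.* n , λ m 2n≤m → begin
  C ℚ.* 1/suc m                       ≤⟨ *-monoʳ (0≤1/suc m) C≤n ⟩
  ι n ℚ.* 1/suc m                     ≡⟨ cong (ℚ._* 1/suc m) ιn≡ ⟩
  ½ ℚ.* ι (2 ℕ.* n) ℚ.* 1/suc m
    ≤⟨ *-monoʳ (0≤1/suc m) (*-monoˡ 0≤½ (ι-mono-≤ (ℕ.m≤n⇒m≤1+n 2n≤m))) ⟩
  ½ ℚ.* ι (suc m) ℚ.* 1/suc m         ≡⟨ ℚ.*-assoc ½ (ι (suc m)) (1/suc m) ⟩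
  ½ ℚ.* (ι (suc m) ℚ.* 1/suc m)       ≡⟨ cong (½ ℚ.*_) (ι*1/suc m) ⟩
  ½ ℚ.* 1ℚ                            ≡⟨⟩
  ½                                   ∎
  where
  open ℚ.≤-Reasoning
  0≤½ : 0ℚ ℚ.≤ ½
  0≤½ = from-yes (0ℚ ℚ.≤? ½)
  ιn≡ : ι n ≡ ½ ℚ.* ι (2 ℕ.* n)
  ιn≡ = sym (trans (cong (½ ℚ.*_) (ι-* 2 n))
    (trans (sym (ℚ.*-assoc ½ (ι 2) (ι n))) (ℚ.*-identityˡ (ι n))))

-- Estimates for (1 + x / M) ^ M

bernoulli : ∀ {p} n → 0ℚ ℚ.≤ p → p ℚ.≤ 1ℚ → 1ℚ ℚ.- ι n ℚ.* p ℚ.≤ (1ℚ ℚ.- p) ^ n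
bernoulli {p} zero    _   _   = ℚ.≤-reflexive (cong (λ e → 1ℚ ℚ.- e) (ℚ.*-zeroˡ p))
bernoulli {p} (suc n) 0≤p p≤1 = begin
  1ℚ ℚ.- ι (suc n) ℚ.* p
    ≡⟨ cong (λ k → 1ℚ ℚ.- k ℚ.* p) (ι-suc n) ⟩
  1ℚ ℚ.- (1ℚ ℚ.+ ι n) ℚ.* p
    ≡⟨ sym (ℚ.+-identityʳ _) ⟩
  1ℚ ℚ.- (1ℚ ℚ.+ ι n) ℚ.* p ℚ.+ 0ℚ
    ≤⟨ ℚ.+-monoʳ-≤ (1ℚ ℚ.- (1ℚ ℚ.+ ι n) ℚ.* p) (*-nonNeg (0≤ι n) (*-nonNeg 0≤p 0≤p)) ⟩
  1ℚ ℚ.- (1ℚ ℚ.+ ι n) ℚ.* p ℚ.+ ι n ℚ.* (p ℚ.* p)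
    ≡⟨ solve 2 (λ k p → con 1ℚ :- (con 1ℚ :+ k) :* p :+ k :* (p :* p)
                     := (con 1ℚ :- p) :* (con 1ℚ :- k :* p)) refl (ι n) p ⟩
  (1ℚ ℚ.- p) ℚ.* (1ℚ ℚ.- ι n ℚ.* p)
    ≤⟨ *-monoˡ 0≤1-p (bernoulli n 0≤p p≤1) ⟩
  (1ℚ ℚ.- p) ^ suc n ∎
  where
  open ℚ.≤-Reasoning
  open ℚSolver.+-*-Solver
  0≤1-p : 0ℚ ℚ.≤ 1ℚ ℚ.- p
  0≤1-p = subst (ℚ._≤ 1ℚ ℚ.- p) (ℚ.+-inverseʳ p) (ℚ.+-monoˡ-≤ (ℚ.- p) p≤1)

1/20 1/40 : ℚ
1/20 = + 1 ℚ./ 20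
1/40 = + 1 ℚ./ 40

1/suc≤1 : ∀ m → 1/suc m ℚ.≤ 1ℚ
1/suc≤1 m = subst₂ ℚ._≤_ (ℚ.*-identityˡ (1/suc m)) (ι*1/suc m)
  (*-monoʳ (0≤1/suc m) (ι-mono-≤ {1} {suc m} (s≤s z≤n)))

-- Multiply by (1 - 1 / (20 M)) ^ M, which is at least 19 / 20.
exp[1/20]-bound : ∀ m → (1ℚ ℚ.+ 1/20 ℚ.* 1/suc m) ^ suc m ℚ.* (+ 19 ℚ./ 20) ℚ.≤ 1ℚ
exp[1/20]-bound m = begin
  (1ℚ ℚ.+ p) ^ suc m ℚ.* (+ 19 ℚ./ 20)
    ≤⟨ *-monoˡ (^-nonNeg (suc m) 0≤1+p) lower ⟩
  (1ℚ ℚ.+ p) ^ suc m ℚ.* (1ℚ ℚ.- p) ^ suc m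
    ≡⟨ sym (^-distrib-* (1ℚ ℚ.+ p) (1ℚ ℚ.- p) (suc m)) ⟩
  ((1ℚ ℚ.+ p) ℚ.* (1ℚ ℚ.- p)) ^ suc m
    ≤⟨ ^-mono-≤ (suc m) (*-nonNeg 0≤1+p 0≤1-p) square ⟩
  1ℚ ^ suc m
    ≡⟨ 1^n≡1 (suc m) ⟩
  1ℚ ∎
  where
  open ℚ.≤-Reasoning
  p : ℚ
  p = 1/20 ℚ.* 1/suc m
  0≤p : 0ℚ ℚ.≤ p
  0≤p = *-nonNeg {1/20} (from-yes (0ℚ ℚ.≤? 1/20)) (0≤1/suc m)
  p≤1 : p ℚ.≤ 1ℚ
  p≤1 = ℚ.≤-trans (*-monoˡ {r = 1/20} (from-yes (0ℚ ℚ.≤? 1/20)) (1/suc≤1 m))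
                  (from-yes (1/20 ℚ.* 1ℚ ℚ.≤? 1ℚ))
  0≤1+p : 0ℚ ℚ.≤ 1ℚ ℚ.+ p
  0≤1+p = ℚ.+-mono-≤ (from-yes (0ℚ ℚ.≤? 1ℚ)) 0≤p
  0≤1-p : 0ℚ ℚ.≤ 1ℚ ℚ.- p
  0≤1-p = subst (ℚ._≤ 1ℚ ℚ.- p) (ℚ.+-inverseʳ p) (ℚ.+-monoˡ-≤ (ℚ.- p) p≤1)
  lower : + 19 ℚ./ 20 ℚ.≤ (1ℚ ℚ.- p) ^ suc m
  lower = subst (ℚ._≤ (1ℚ ℚ.- p) ^ suc m) (cong (λ e → 1ℚ ℚ.- e) ιp≡)
                (bernoulli (suc m) 0≤p p≤1)
    where
    open ℚSolver.+-*-Solver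
    ιp≡ : ι (suc m) ℚ.* p ≡ 1/20
    ιp≡ = trans (solve 3 (λ k c r → k :* (c :* r) := c :* (k :* r)) refl
                  (ι (suc m)) 1/20 (1/suc m))
                (cong (1/20 ℚ.*_) (ι*1/suc m))
  square : (1ℚ ℚ.+ p) ℚ.* (1ℚ ℚ.- p) ℚ.≤ 1ℚ
  square = begin
    (1ℚ ℚ.+ p) ℚ.* (1ℚ ℚ.- p)
      ≡⟨ solve 1 (λ p → (con 1ℚ :+ p) :* (con 1ℚ :- p) := con 1ℚ :- p :* p) refl p ⟩
    1ℚ ℚ.- p ℚ.* p
      ≤⟨ ℚ.+-monoʳ-≤ 1ℚ (ℚ.neg-antimono-≤ (*-nonNeg 0≤p 0≤p)) ⟩
    1ℚ ∎
    where open ℚSolver.+-*-Solver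

-- With a = 1 + t / M ≥ 1/2 one has 1 + s / M ≤ a + 1 / (40 M) ≤ a (1 + 1 / (20 M)).
exp-bound : ∀ m s t C → s ℚ.≤ t ℚ.+ 1/40 → ℚ.- C ℚ.≤ s → ℚ.- C ℚ.≤ t →
  C ℚ.* 1/suc m ℚ.≤ ½ → (1ℚ ℚ.+ t ℚ.* 1/suc m) ^ suc m ℚ.≤ ι 181 →
  (1ℚ ℚ.+ s ℚ.* 1/suc m) ^ suc m ℚ.≤ ι 191
exp-bound m s t C s≤t -C≤s -C≤t Cr≤½ bound =
  ℚ.*-cancelʳ-≤-pos (+ 19 ℚ./ 20) (begin
    (1ℚ ℚ.+ s ℚ.* r) ^ suc m ℚ.* c
      ≤⟨ *-monoʳ 0≤c (^-mono-≤ (suc m) (ℚ.≤-trans 0≤½ (½≤ s -C≤s)) step) ⟩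
    (a ℚ.* b) ^ suc m ℚ.* c
      ≡⟨ cong (ℚ._* c) (^-distrib-* a b (suc m)) ⟩
    a ^ suc m ℚ.* b ^ suc m ℚ.* c
      ≡⟨ ℚ.*-assoc (a ^ suc m) (b ^ suc m) c ⟩
    a ^ suc m ℚ.* (b ^ suc m ℚ.* c)
      ≤⟨ *-monoˡ (^-nonNeg (suc m) 0≤a) (exp[1/20]-bound m) ⟩
    a ^ suc m ℚ.* 1ℚ
      ≤⟨ *-monoʳ {r = 1ℚ} (from-yes (0ℚ ℚ.≤? 1ℚ)) bound ⟩
    ι 181 ℚ.* 1ℚ
      -- 191 * 19 / 20 = 181.45.
      ≤⟨ from-yes (ι 181 ℚ.* 1ℚ ℚ.≤? ι 191 ℚ.* c) ⟩
    ι 191 ℚ.* c ∎)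
  where
  open ℚ.≤-Reasoning
  open ℚSolver.+-*-Solver
  r a b c : ℚ
  r = 1/suc m
  a = 1ℚ ℚ.+ t ℚ.* r
  b = 1ℚ ℚ.+ 1/20 ℚ.* r
  c = + 19 ℚ./ 20
  0≤c : 0ℚ ℚ.≤ c
  0≤c = from-yes (0ℚ ℚ.≤? c)
  0≤½ : 0ℚ ℚ.≤ ½
  0≤½ = from-yes (0ℚ ℚ.≤? ½)
  ½≤ : ∀ u → ℚ.- C ℚ.≤ u → ½ ℚ.≤ 1ℚ ℚ.+ u ℚ.* r
  ½≤ u -C≤u = begin
    1ℚ ℚ.- ½               ≤⟨ ℚ.+-monoʳ-≤ 1ℚ (ℚ.neg-antimono-≤ Cr≤½) ⟩
    1ℚ ℚ.- C ℚ.* r         ≡⟨ cong (λ e → 1ℚ ℚ.+ e) (ℚ.neg-distribˡ-* C r) ⟩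
    1ℚ ℚ.+ (ℚ.- C) ℚ.* r   ≤⟨ ℚ.+-monoʳ-≤ 1ℚ (*-monoʳ (0≤1/suc m) -C≤u) ⟩
    1ℚ ℚ.+ u ℚ.* r         ∎
  0≤a : 0ℚ ℚ.≤ a
  0≤a = ℚ.≤-trans 0≤½ (½≤ t -C≤t)
  step : 1ℚ ℚ.+ s ℚ.* r ℚ.≤ a ℚ.* b
  step = begin
    1ℚ ℚ.+ s ℚ.* r
      ≤⟨ ℚ.+-monoʳ-≤ 1ℚ (*-monoʳ (0≤1/suc m) s≤t) ⟩
    1ℚ ℚ.+ (t ℚ.+ 1/40) ℚ.* r
      ≡⟨ solve 2 (λ t r → con 1ℚ :+ (t :+ con 1/40) :* r
                       := con 1ℚ :+ t :* r :+ con ½ :* (con 1/20 :* r)) refl t r ⟩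
    a ℚ.+ ½ ℚ.* (1/20 ℚ.* r)
      ≤⟨ ℚ.+-monoʳ-≤ a (*-monoʳ
           (*-nonNeg {1/20} (from-yes (0ℚ ℚ.≤? 1/20)) (0≤1/suc m)) (½≤ t -C≤t)) ⟩
    a ℚ.+ a ℚ.* (1/20 ℚ.* r)
      ≡⟨ solve 2 (λ a d → a :+ a :* d := a :* (con 1ℚ :+ d)) refl a (1/20 ℚ.* r) ⟩
    a ℚ.* b ∎

-- Passage to the limit

seq-^ʳ : ∀ u n q → seq (u ^ʳ n) q ≡ seq u q ^ n
seq-^ʳ u zero    q = refl
seq-^ʳ u (suc n) q = cong (seq u q ℚ.*_) (seq-^ʳ u n q)

-- Applied to `s`, this keeps the base 1 + s / M positive for large M, where powers are monotone.
eventually-≥ : ∀ u → ∃ λ B → ∃ λ N → ∀ n → N ℕ.≤ n → ℚ.- B ℚ.≤ seq u n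
eventually-≥ u with cauchy u 1ℚ (ℚ.positive⁻¹ 1ℚ)
... | N , close = 1ℚ ℚ.- seq u N , N , λ n N≤n → begin
  ℚ.- (1ℚ ℚ.- seq u N)
    ≡⟨ solve 1 (λ a → :- (con 1ℚ :- a) := a :- con 1ℚ) refl (seq u N) ⟩
  seq u N ℚ.- 1ℚ
    ≤⟨ ℚ.+-monoʳ-≤ (seq u N) (ℚ.neg-antimono-≤
         (ℚ.≤-trans (p≤∣p∣ _) (close N n ℕ.≤-refl N≤n))) ⟩
  seq u N ℚ.- (seq u N ℚ.- seq u n)
    ≡⟨ solve 2 (λ a b → a :- (a :- b) := b) refl (seq u N) (seq u n) ⟩
  seq u n ∎
  where
  open ℚ.≤-Reasoning
  open ℚSolver.+-*-Solver
  p≤∣p∣ : ∀ p → p ℚ.≤ ℚ.∣ p ∣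
  p≤∣p∣ p with ℚ.≤-total 0ℚ p
  ... | inj₁ 0≤p = ℚ.≤-reflexive (sym (ℚ.0≤p⇒∣p∣≡p 0≤p))
  ... | inj₂ p≤0 = ℚ.≤-trans p≤0 (ℚ.0≤∣p∣ p)

-- Raising the base from 180 to 181 absorbs the constant 10 and the extra 1, which leaves room for
-- the error in approximating T by powers.
T<suc[growth]^n : ∀ T → CountsBuildings T → ∀ n → suc (T (suc n)) ℕ.≤ suc growth ℕ.^ suc n
T<suc[growth]^n T counts n = begin
  suc (T (suc n))                  ≤⟨ ℕ.s≤s (T≤10*growth^n T counts n) ⟩
  1 ℕ.+ 10 ℕ.* growth ℕ.^ n        ≤⟨ ℕ.+-mono-≤ (ℕ.m^n>0 (suc growth) n)
                                        (ℕ.*-monoʳ-≤ 10 (ℕ.^-monoˡ-≤ n (ℕ.n≤1+n growth))) ⟩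
  11 ℕ.* suc growth ℕ.^ n          ≤⟨ ℕ.*-monoˡ-≤ (suc growth ℕ.^ n) 11≤ ⟩
  suc growth ℕ.* suc growth ℕ.^ n  ∎
  where
  open ℕ.≤-Reasoning
  11≤ : 11 ℕ.≤ suc growth
  11≤ = subst (λ g → 11 ℕ.≤ suc g) (sym growth≡180) (from-yes (11 ℕ.≤? 181))

-- With N = n + 1 and M = m + 1, the index `m + n * suc m` is the predecessor of N M, so the
-- corresponding term of the exponential sequence is an N-th power.
^-split : ∀ n m l → (1ℚ ℚ.+ l ℚ.* 1/suc (m ℕ.+ n ℕ.* suc m)) ^ (suc n ℕ.* suc m) ≡
  ((1ℚ ℚ.+ l ℚ.* 1/suc n ℚ.* 1/suc m) ^ suc m) ^ suc n
^-split n m l = begin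
  (1ℚ ℚ.+ l ℚ.* 1/suc (m ℕ.+ n ℕ.* suc m)) ^ (suc n ℕ.* suc m)
    ≡⟨ cong₂ _^_ base (ℕ.*-comm (suc n) (suc m)) ⟩
  (1ℚ ℚ.+ l ℚ.* 1/suc n ℚ.* 1/suc m) ^ (suc m ℕ.* suc n)
    ≡⟨ sym (^-assocʳ (1ℚ ℚ.+ l ℚ.* 1/suc n ℚ.* 1/suc m) (suc m) (suc n)) ⟩
  ((1ℚ ℚ.+ l ℚ.* 1/suc n ℚ.* 1/suc m) ^ suc m) ^ suc n ∎
  where
  open ≡-Reasoning
  base : 1ℚ ℚ.+ l ℚ.* 1/suc (m ℕ.+ n ℕ.* suc m) ≡ 1ℚ ℚ.+ l ℚ.* 1/suc n ℚ.* 1/suc m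
  base = cong (λ e → 1ℚ ℚ.+ e)
    (trans (cong (l ℚ.*_) (sym (1/suc-* n m))) (sym (ℚ.*-assoc l (1/suc n) (1/suc m))))

growth-root : ∀ {T} → CountsBuildings T → ∀ n p →
  p ^ suc n ℚ.≤ ι (T (suc n)) ℚ.+ 1ℚ → p ℚ.≤ ι 181
growth-root {T} counts n p pⁿ≤ = subst (λ g → p ℚ.≤ ι (suc g)) growth≡180
  (^-cancel-≤ n (0≤ι (suc growth)) (begin
    p ^ suc n                      ≤⟨ pⁿ≤ ⟩
    ι (T (suc n)) ℚ.+ 1ℚ           ≡⟨ ℚ.+-comm (ι (T (suc n))) 1ℚ ⟩
    1ℚ ℚ.+ ι (T (suc n))           ≡⟨ sym (ι-suc (T (suc n))) ⟩
    ι (suc (T (suc n)))            ≤⟨ ι-mono-≤ (T<suc[growth]^n T counts n) ⟩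
    ι (suc growth ℕ.^ suc n)       ≡⟨ ι-^ (suc growth) (suc n) ⟩
    ι (suc growth) ^ suc n         ∎))
  where open ℚ.≤-Reasoning

eventually-both : ∀ {P Q : ℕ → Set} → (∃ λ N → ∀ n → N ℕ.≤ n → P n) →
  (∃ λ N → ∀ n → N ℕ.≤ n → Q n) → ∃ λ N → ∀ n → N ℕ.≤ n → P n × Q n
eventually-both (M , P≥) (N , Q≥) = M ℕ.⊔ N , λ n n≥ →
  P≥ n (ℕ.m⊔n≤o⇒m≤o M N n≥) , Q≥ n (ℕ.m⊔n≤o⇒n≤o M N n≥)

0<⅛ : 0ℚ ℚ.< + 1 / 8
0<⅛ = from-yes (0ℚ ℚ.<? + 1 / 8)

0<½ : 0ℚ ℚ.< ½
0<½ = from-yes (0ℚ ℚ.<? ½)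

0<1/80 : 0ℚ ℚ.< + 1 / 80
0<1/80 = from-yes (0ℚ ℚ.<? + 1 / 80)

theorem3p3 : (T : ℕ → ℕ) → CountsBuildings T →
    (s h : ℝ) → IsEntropy T s → h IsExpOf s →
    h ≤ʳ fromℚ (+ 19135 / 100)
theorem3p3 T counts s h (logT , isLog , logT/n⟶s) h-exp ε 0<ε =
  -- The indices are fixed in turn: N = n + 1, then M = m + 1, then q in the rational sequences. The
  -- tolerance 1/80 is spent twice, by the limit and by `≤ʳ`, which makes the 1/40 of `exp-bound`.
  let n , entropy    = logT/n⟶s (+ 1 / 80) 0<1/80
      B , s-below    = eventually-≥ s
      -- Again spent twice: the total error 1 is the one allowed in `growth-root`.
      K₁ , exp-log   = isLog (suc n) ½ 0<½
      K₂ , exp-s     = h-exp (+ 1 / 8) 0<⅛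
      -- If s ≥ -B, then log T(N) / N, being at least s - 1/40, is at least -(B + 1/40).
      m₀ , half      = eventually-half (B ℚ.+ 1/40)
      m              = m₀ ℕ.⊔ (K₁ ℕ.⊔ K₂)
      m₀≤m           = ℕ.m≤m⊔n m₀ (K₁ ℕ.⊔ K₂)
      K₁≤m           = ℕ.≤-trans (ℕ.m≤m⊔n K₁ K₂) (ℕ.m≤n⊔m m₀ (K₁ ℕ.⊔ K₂))
      K₂≤m           = ℕ.≤-trans (ℕ.m≤n⊔m K₁ K₂) (ℕ.m≤n⊔m m₀ (K₁ ℕ.⊔ K₂))
      Q , all        = eventually-both s-below
        (eventually-both (proj₂ (entropy n ℕ.≤-refl) (+ 1 / 80) 0<1/80)
        (eventually-both
          (proj₁ (exp-log (m ℕ.+ n ℕ.* suc m) (ℕ.≤-trans K₁≤m (ℕ.m≤m+n m _))) ½ 0<½)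
          (proj₂ (exp-s m K₂≤m) (+ 1 / 8) 0<⅛)))
  in Q , λ q Q≤q →
    let -B≤s , s≤t , T-bound , h-bound = all q Q≤q
    in final n m q B -B≤s s≤t T-bound h-bound (half m m₀≤m)
  where
  open ℚ.≤-Reasoning
  open ℚSolver.+-*-Solver
  final : ∀ n m q B → ℚ.- B ℚ.≤ seq s q →
    seq s q ℚ.≤ seq (logT (suc n)) q ℚ.* 1/suc n ℚ.+ + 1 / 80 ℚ.+ + 1 / 80 →
    seq ((fromℚ 1ℚ +ʳ logT (suc n) ÷ suc (m ℕ.+ n ℕ.* suc m)) ^ʳ (suc n ℕ.* suc m)) q
      ℚ.≤ ι (T (suc n)) ℚ.+ ½ ℚ.+ ½ →
    seq h q ℚ.≤ seq ((fromℚ 1ℚ +ʳ s ÷ suc m) ^ʳ suc m) q ℚ.+ + 1 / 8 ℚ.+ + 1 / 8 →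
    (B ℚ.+ 1/40) ℚ.* 1/suc m ℚ.≤ ½ →
    seq h q ℚ.≤ + 19135 / 100 ℚ.+ ε
  final n m q B -B≤s s≤t T-bound h-bound half = begin
    seq h q
      ≤⟨ h-bound ⟩
    seq ((fromℚ 1ℚ +ʳ s ÷ suc m) ^ʳ suc m) q ℚ.+ + 1 / 8 ℚ.+ + 1 / 8
      ≡⟨ cong (λ e → e ℚ.+ + 1 / 8 ℚ.+ + 1 / 8) (seq-^ʳ (fromℚ 1ℚ +ʳ s ÷ suc m) (suc m) q) ⟩
    (1ℚ ℚ.+ seq s q ℚ.* 1/suc m) ^ suc m ℚ.+ + 1 / 8 ℚ.+ + 1 / 8
      ≤⟨ ℚ.+-monoˡ-≤ (+ 1 / 8) (ℚ.+-monoˡ-≤ (+ 1 / 8) s-bound) ⟩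
    ι 191 ℚ.+ + 1 / 8 ℚ.+ + 1 / 8
      -- The two tolerances of 1/8 raise 191 to 191.25, still below 191.35.
      ≤⟨ from-yes (ι 191 ℚ.+ + 1 / 8 ℚ.+ + 1 / 8 ℚ.≤? + 19135 / 100 ℚ.+ 0ℚ) ⟩
    + 19135 / 100 ℚ.+ 0ℚ
      ≤⟨ ℚ.+-monoʳ-≤ (+ 19135 / 100) (ℚ.<⇒≤ 0<ε) ⟩
    + 19135 / 100 ℚ.+ ε ∎
    where
    l t C : ℚ
    l = seq (logT (suc n)) q
    t = l ℚ.* 1/suc n
    C = B ℚ.+ 1/40
    s≤t+1/40 : seq s q ℚ.≤ t ℚ.+ 1/40
    s≤t+1/40 = ℚ.≤-trans s≤t (ℚ.≤-reflexive (ℚ.+-assoc t (+ 1 / 80) (+ 1 / 80)))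
    -C≤s : ℚ.- C ℚ.≤ seq s q
    -C≤s = ℚ.≤-trans (ℚ.neg-antimono-≤ (begin
      B             ≡⟨ sym (ℚ.+-identityʳ B) ⟩
      B ℚ.+ 0ℚ      ≤⟨ ℚ.+-monoʳ-≤ B (from-yes (0ℚ ℚ.≤? 1/40)) ⟩
      C             ∎)) -B≤s
    -C≤t : ℚ.- C ℚ.≤ t
    -C≤t = begin
      ℚ.- C                  ≡⟨ ℚ.neg-distrib-+ B 1/40 ⟩
      ℚ.- B ℚ.- 1/40         ≤⟨ ℚ.+-monoˡ-≤ (ℚ.- 1/40) (ℚ.≤-trans -B≤s s≤t+1/40) ⟩
      t ℚ.+ 1/40 ℚ.- 1/40    ≡⟨ solve 1 (λ t → t :+ con 1/40 :- con 1/40 := t) refl t ⟩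
      t                      ∎
    t-bound : (1ℚ ℚ.+ t ℚ.* 1/suc m) ^ suc m ℚ.≤ ι 181
    t-bound = growth-root counts n _ (begin
      ((1ℚ ℚ.+ t ℚ.* 1/suc m) ^ suc m) ^ suc n
        ≡⟨ sym (^-split n m l) ⟩
      (1ℚ ℚ.+ l ℚ.* 1/suc (m ℕ.+ n ℕ.* suc m)) ^ (suc n ℕ.* suc m)
        ≡⟨ sym (seq-^ʳ (fromℚ 1ℚ +ʳ logT (suc n) ÷ suc (m ℕ.+ n ℕ.* suc m)) (suc n ℕ.* suc m) q) ⟩
      _ ≤⟨ T-bound ⟩
      ι (T (suc n)) ℚ.+ ½ ℚ.+ ½
        ≡⟨ ℚ.+-assoc (ι (T (suc n))) ½ ½ ⟩
      ι (T (suc n)) ℚ.+ 1ℚ ∎)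
    s-bound : (1ℚ ℚ.+ seq s q ℚ.* 1/suc m) ^ suc m ℚ.≤ ι 191
    s-bound = exp-bound m (seq s q) t C s≤t+1/40 -C≤s -C≤t half t-bound
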